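{- Let $d\ge 1$ and let $X$ be a finite pure $d$-dimensional simplicial complex which is an $\alpha$-skeleton expander. If $\alpha < (\sqrt[2^d]{2}-1)/\sqrt{2}$, then $X$ is an $\epsilon$-colorful expander for $$\epsilon = \left(\frac{\sqrt[2^d]{2}-1-\sqrt2\alpha}{2\sqrt2\,d}\right)^d.$$
   Context: A simplicial complex $X$ on a finite vertex set is a family of subsets (faces) closed under taking subsets; it contains the empty face $\emptyset$. A face $\sigma$ has dimension $|\sigma|-1$; $X(i)$ is the set of $i$-dimensional faces ($X(-1)=\{\emptyset\}$). $X$ is $d$-dimensional if its maximal face dimension is $d$, and pure if every face is contained in a $d$-face. The degree $\deg(\sigma)$ of a face is the number of $d$-faces containing it. An $i$-cochain is a subset $W\subseteq X(i)$; $C^i(X)$ denotes the set of $i$-cochains. The norm of $W\in C^i(X)$ is $\|W\|=\sum_{\sigma\in W}\deg(\sigma)/\sum_{\tau\in X(i)}\deg(\tau)$. The link of a face $\sigma$ is $X_\sigma=\{\tau\setminus\sigma:\tau\in X,\ \tau\supseteq\sigma\}$, a pure complex of dimension $d-|\sigma|$; $\|\cdot\|_\sigma$ denotes the norm computed inside $X_\sigma$ (degrees counted as numbers of top-dimensional faces of $X_\sigma$). $X$ is an $\alpha$-skeleton expander ($\alpha>0$) if for every face $\sigma\in X$ (including $\sigma=\emptyset$, for which $X_\emptyset=X$) and every $S\subseteq X_\sigma(0)$, $\|E(S)\|_\sigma\le\|S\|_\sigma(\|S\|_\sigma+\alpha)$, where $E(S)\subseteq X_\sigma(1)$ is the set of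 edges of $X_\sigma$ with both endpoints in $S$. For $W\in C^i(X)$, $0\le i<d$, the expanding faces are $\psi(W)=\{\tau\in X(i+1):\exists\,\sigma,\sigma'\subset\tau \text{ with } \sigma\in W,\ \sigma'\in X(i)\setminus W\}$. $X$ is an $\epsilon$-colorful expander ($\epsilon>0$) if for every $0\le i<d$ and every $W\in C^i(X)$ with $0<\|W\|\le 1/2$, one has $\|\psi(W)\|/\|W\|\ge\epsilon$.
   Formalization: The parameter α is taken rational, and the bound ‖ψ(W)‖ ≥ ε‖W‖ is stated as ‖ψ(W)‖ ≥ t^d‖W‖ for every rational t with 0 < t < (2^{1/2^d} − 1 − √2α)/(2√2 d); the real form follows by density, since skeleton expansion is monotone in α. -}

module Defs where

open import Data.Bool using (Bool; true; false; _∧_; _∨_; not; T; if_then_else_)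
open import Data.Nat as ℕ using (ℕ; zero; suc; _≡ᵇ_)
open import Data.Integer using (+_)
open import Data.Rational using (ℚ; 0ℚ; 1ℚ; _+_; _*_; _-_; _<_; _≤_; _/_)
open import Data.Vec using (Vec; []; _∷_)
open import Data.List using (List; []; _∷_; _++_; map)
open import Data.Nat.ListAction using (sum)
open import Data.Bool.ListAction using (any)
open import Data.Fin.Subset using (Subset; ∣_∣; outside; inside; _∪_; _∩_)
open import Data.Product using (_×_; _,_; Σ)
open import Data.Sum using (_⊎_)
open import Relation.Binary.PropositionalEquality using (_≡_)

_⊆ᵇ_ : ∀ {n} → Subset n → Subset n → Bool
[] ⊆ᵇ [] = true
(false ∷ p) ⊆ᵇ (_ ∷ q) = p ⊆ᵇ q
(true ∷ p) ⊆ᵇ (b ∷ q) = b ∧ (p ⊆ᵇ q)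

disjointᵇ : ∀ {n} → Subset n → Subset n → Bool
disjointᵇ [] [] = true
disjointᵇ (a ∷ p) (b ∷ q) = not (a ∧ b) ∧ disjointᵇ p q

allSubsets : (n : ℕ) → List (Subset n)
allSubsets zero = [] ∷ []
allSubsets (suc n) = map (outside ∷_) (allSubsets n) ++ map (inside ∷_) (allSubsets n)

-- Simplicial complexes on vertex set Fin n, given by the characteristic
-- function of the family of faces.  σ has dimension ∣ σ ∣ - 1.

Family : ℕ → Set
Family n = Subset n → Bool

∅ : ∀ {n} → Subset n
∅ {n} = Data.Vec.replicate n outside

IsComplex : ∀ {n} → Family n → Set
IsComplex X = T (X ∅) × (∀ σ τ → T (τ ⊆ᵇ σ) → T (X σ) → T (X τ))

IsDimension : ∀ {n} → Family n → ℕ → Set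
IsDimension X d = (∀ σ → T (X σ) → ∣ σ ∣ ℕ.≤ suc d)
                × Σ (Subset _) (λ τ → T (X τ) × ∣ τ ∣ ≡ suc d)

IsPure : ∀ {n} → Family n → ℕ → Set
IsPure X d = ∀ σ → T (X σ) →
  Σ (Subset _) (λ τ → T (X τ) × ∣ τ ∣ ≡ suc d × T (σ ⊆ᵇ τ))

-- Degrees and norms.  Norms are computed relative to a top dimension D
-- (D = d for X itself, D = d - |σ| for the link of σ).  A cochain
-- W ∈ C^i is a boolean predicate; only the i-faces of X satisfying it count.

count : ∀ {n} → (Subset n → Bool) → ℕ
count {n} P = sum (map (λ τ → if P τ then 1 else 0) (allSubsets n))

deg : ∀ {n} → Family n → ℕ → Subset n → ℕ
deg X D σ = count (λ τ → X τ ∧ (∣ τ ∣ ≡ᵇ suc D) ∧ (σ ⊆ᵇ τ))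

degSum : ∀ {n} → Family n → ℕ → ℕ → (Subset n → Bool) → ℕ
degSum {n} X D i P =
  sum (map (λ σ → if P σ ∧ X σ ∧ (∣ σ ∣ ≡ᵇ suc i) then deg X D σ else 0) (allSubsets n))

frac : ℕ → ℕ → ℚ
frac a zero = 0ℚ
frac a (suc b) = (+ a) / suc b

norm : ∀ {n} → Family n → ℕ → ℕ → (Subset n → Bool) → ℚ
norm X D i W = frac (degSum X D i W) (degSum X D i (λ _ → true))

-- Links:  X_σ = { τ \ σ : τ ∈ X, τ ⊇ σ }, realised on the same vertex set
-- Fin n as { ρ : ρ ∩ σ = ∅, ρ ∪ σ ∈ X }.  Its dimension is d - |σ|.

link : ∀ {n} → Family n → Subset n → Family n
link X σ ρ = disjointᵇ ρ σ ∧ X (ρ ∪ σ)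

vertCochain : ∀ {n} → Subset n → (Subset n → Bool)
vertCochain S ρ = (∣ ρ ∣ ≡ᵇ 1) ∧ (ρ ⊆ᵇ S)

E : ∀ {n} → Subset n → (Subset n → Bool)
E S ρ = (∣ ρ ∣ ≡ᵇ 2) ∧ (ρ ⊆ᵇ S)

IsSkeletonExpander : ∀ {n} → Family n → ℕ → ℚ → Set
IsSkeletonExpander {n} X d α =
  ∀ (σ : Subset n) → T (X σ) →
  ∀ (S : Subset n) → (∀ ρ → T (vertCochain S ρ) → T (link X σ ρ)) →
  let D = d ℕ.∸ ∣ σ ∣
      nS = norm (link X σ) D 0 (vertCochain S)
  in norm (link X σ) D 1 (E S) ≤ nS * (nS + α)

ψ : ∀ {n} → Family n → ℕ → (Subset n → Bool) → (Subset n → Bool)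
ψ {n} X i W τ =
  (∣ τ ∣ ≡ᵇ suc (suc i)) ∧ X τ
  ∧ any (λ σ → (σ ⊆ᵇ τ) ∧ (∣ σ ∣ ≡ᵇ suc i) ∧ W σ ∧ X σ) (allSubsets n)
  ∧ any (λ σ → (σ ⊆ᵇ τ) ∧ (∣ σ ∣ ≡ᵇ suc i) ∧ X σ ∧ not (W σ)) (allSubsets n)

-- Exact arithmetic in ℚ(√2):  ⟨ a , b ⟩ represents a + b√2.

record Q√2 : Set where
  constructor ⟨_,_⟩
  field re : ℚ
        ir : ℚ

_⊗_ : Q√2 → Q√2 → Q√2
⟨ a , b ⟩ ⊗ ⟨ c , e ⟩ = ⟨ a * c + (+ 2 / 1) * (b * e) , a * e + b * c ⟩

_^√_ : Q√2 → ℕ → Q√2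
x ^√ zero = ⟨ 1ℚ , 0ℚ ⟩
x ^√ suc k = x ⊗ (x ^√ k)

-- a + b√2 < 2, i.e. b√2 < c with c = 2 - a
Lt2 : Q√2 → Set
Lt2 ⟨ a , b ⟩ =
  let c = (+ 2 / 1) - a in
  (0ℚ ≤ b × 0ℚ < c × (+ 2 / 1) * (b * b) < c * c)
  ⊎ (b < 0ℚ × (0ℚ ≤ c ⊎ c * c < (+ 2 / 1) * (b * b)))

_^q_ : ℚ → ℕ → ℚ
q ^q zero = 1ℚ
q ^q suc k = q * (q ^q k)

-- "β < (2^{1/2^d} - 1)/√2"  ⟺  (1 + √2 β)^(2^d) < 2   (for β ≥ 0)
BelowRoot : ℕ → ℚ → Set
BelowRoot d β = Lt2 (⟨ 1ℚ , β ⟩ ^√ (2 ℕ.^ d))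

-- X is ε_d(α)-colorful, ε_d(α) = ((2^{1/2^d} - 1 - √2α)/(2√2 d))^d:
-- for every W as in the definition, ‖ψ(W)‖ ≥ ε‖W‖, expressed as
-- ‖ψ(W)‖ ≥ t^d ‖W‖ for every rational t with 0 < t < (2^{1/2^d}-1-√2α)/(2√2 d),
-- where t < that bound ⟺ 2dt + α < (2^{1/2^d}-1)/√2.
IsColorfulBound : ∀ {n} → Family n → ℕ → ℚ → Set
IsColorfulBound {n} X d α =
  ∀ (i : ℕ) → i ℕ.< d →
  ∀ (W : Subset n → Bool) → (∀ σ → T (W σ) → T (X σ) × ∣ σ ∣ ≡ suc i) →
  0ℚ < norm X d i W → norm X d i W ≤ (+ 1 / 2) →
  ∀ (t : ℚ) → 0ℚ < t → BelowRoot d ((+ (2 ℕ.* d) / 1) * t + α) →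
  (t ^q d) * norm X d i W ≤ norm X d (suc i) (ψ X i W)

{-# OPTIONS --safe #-}
module Submission where

-- Give a face σ the weight μ σ proportional to its degree, normalised so that the faces
-- with k vertices have total weight 1; then the cofaces of σ have total weight (∣σ∣ + 1) μ σ.
-- Put γ = 2dt, β = γ + α and c = 1 - β.  The hypothesis on the 2^d-th root forces
-- 2^d β < 1, hence 2dβ < 1.
--
-- Starting from S_{i+1} = W, let S_k be the set of faces σ with k vertices for which at
-- least a fraction c of the cofaces lies in S_{k+1}.  Then c‖S_k‖ ≤ ‖S_{k+1}‖, so
-- ‖S_0‖ ≤ ‖W‖ + dβ < 1 and the empty face is not in S_0.
--
-- Let Δ_k be the weight of the pairs σ ⋖ τ with ∣σ∣ = k on which S_k and S_{k+1} disagree.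
-- Around every σ the disagreeing cofaces form at most a fraction c of all cofaces, so
-- skeleton expansion in the link of σ gives γ Δ_k ≤ (k+1) ‖ψ(S_{k+1})‖.  Conversely a mixed
-- face contains a facet disagreeing with it, so ‖ψ(S_{k+1})‖ ≤ Δ_{k+1}.  Together with
-- (k+1) ‖S_{k+1}‖ ≤ Δ_k + (k+1) ‖S_k‖ and ‖S_0‖ = 0 this yields t^k ‖S_{k+1}‖ ≤ Δ_k by
-- induction, and finally t^(i+1) ‖W‖ ≤ ‖ψ(W)‖.

open import Defs
open import Data.Bool using (Bool; true; false; _∧_; not; _xor_; T; if_then_else_)
open import Data.Bool.ListAction using (any)
open import Data.Bool.Properties using (T-∧; T-≡; T?)
open import Data.Empty using (⊥-elim)
open import Data.Fin using (zero; suc)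
open import Data.Fin.Subset using (Subset; ∣_∣; _∪_; _─_; ⁅_⁆; _⊆_; _∈_; _∉_)
open import Data.Fin.Subset.Properties using (drop-there; drop-∷-⊆; ⊆-trans; p⊆p∪q; q⊆p∪q; x∈p∪q⁻; p⊆q⇒∣p∣≤∣q∣; x∈⁅y⁆⇒x≡y; x∈⁅x⁆; ∣⁅x⁆∣≡1; p─q⊆p)
import Data.Integer as ℤ
import Data.Integer.Properties as ℤ
open import Data.List using (List; []; _∷_; _++_; map)
open import Data.List.Membership.Propositional as List using (lose; find)
open import Data.List.Membership.Propositional.Properties using (∈-map⁺; ∈-++⁺ˡ; ∈-++⁺ʳ)
open import Data.List.Properties using (map-++; map-∘)
open import Data.List.Relation.Unary.Any as Any using ()
open import Data.List.Relation.Unary.Any.Properties using (any⁺; any⁻)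
open import Data.Nat as ℕ using (ℕ; zero; suc; _≥_; _≡ᵇ_; _∸_)
open import Data.Nat.ListAction using (sum)
open import Data.Nat.ListAction.Properties using (sum-++)
import Data.Nat.Properties as ℕ
open import Data.Product using (_×_; _,_; proj₁; proj₂; ∃)
open import Data.Rational using (ℚ; 0ℚ; 1ℚ; ½; _+_; _*_; _-_; -_; _<_; _≤_; _/_; nonNegative; positive; toℚᵘ)
open import Data.Rational.Properties
open import Data.Rational.Solver using (module +-*-Solver)
import Data.Rational.Unnormalised as ℚᵘ
import Data.Rational.Unnormalised.Properties as ℚᵘ
open import Data.Sum using (_⊎_; inj₁; inj₂; [_,_]′)
open import Data.Unit using (tt)
open import Data.Vec using ([]; _∷_; tabulate; here; there)
open import Data.Vec.Properties using (lookup∘tabulate; []=⇒lookup; lookup⇒[]=)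
open import Function using (_∘_; Equivalence)
open import Relation.Binary.PropositionalEquality using (_≡_; refl; sym; trans; cong; cong₂; subst; module ≡-Reasoning)
open import Relation.Nullary using (¬_; yes; no)
open import Relation.Nullary.Decidable using (⌊_⌋; toWitness; fromWitness)
open +-*-Solver using (solve; _:=_; _:+_; _:*_; _:-_; con)

private
  variable
    n : ℕ
    p q u : ℚ

-- Ordered-field arithmetic, indicators and sums over all subsets

*-nonneg : 0ℚ ≤ p → 0ℚ ≤ q → 0ℚ ≤ p * q
*-nonneg {p} {q} 0≤p 0≤q = nonNegative⁻¹ (p * q) {{nonNeg*nonNeg⇒nonNeg p {{nonNegative 0≤p}} q {{nonNegative 0≤q}}}}

+-nonneg : 0ℚ ≤ p → 0ℚ ≤ q → 0ℚ ≤ p + q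
+-nonneg = +-mono-≤

*-monoˡ-≤ : 0ℚ ≤ u → p ≤ q → u * p ≤ u * q
*-monoˡ-≤ {u} 0≤u = *-monoˡ-≤-nonNeg u {{nonNegative 0≤u}}

*-monoʳ-≤ : 0ℚ ≤ u → p ≤ q → p * u ≤ q * u
*-monoʳ-≤ {u} 0≤u = *-monoʳ-≤-nonNeg u {{nonNegative 0≤u}}

*-cancelˡ-≤ : 0ℚ < u → u * p ≤ u * q → p ≤ q
*-cancelˡ-≤ {u} 0<u = *-cancelˡ-≤-pos u {{positive 0<u}}

p≤q⇒0≤q-p : p ≤ q → 0ℚ ≤ q - p
p≤q⇒0≤q-p {p} {q} p≤q = subst (_≤ q - p) (+-inverseʳ p) (+-monoˡ-≤ (- p) p≤q)

≤-by-difference : q ≡ p + u → 0ℚ ≤ u → p ≤ q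
≤-by-difference {q} {p} {u} q≡p+u 0≤u = begin
  p       ≡⟨ +-identityʳ p ⟨
  p + 0ℚ  ≤⟨ +-monoʳ-≤ p 0≤u ⟩
  p + u   ≡⟨ q≡p+u ⟨
  q       ∎
  where open ≤-Reasoning

≤⇒≯ : p ≤ q → ¬ (q < p)
≤⇒≯ p≤q q<p = <-irrefl refl (<-≤-trans q<p p≤q)

0≤1 : 0ℚ ≤ 1ℚ
0≤1 = nonNegative⁻¹ 1ℚ

-- Defined by recursion so that `ι (suc m)` unfolds to `1ℚ + ι m`, a form that inductions on
-- cardinalities and the ring solver can use directly.
ι : ℕ → ℚ
ι zero    = 0ℚ
ι (suc m) = 1ℚ + ι m

ι-nonneg : ∀ m → 0ℚ ≤ ι m
ι-nonneg zero    = ≤-refl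
ι-nonneg (suc m) = +-nonneg 0≤1 (ι-nonneg m)

ι-suc-pos : ∀ m → 0ℚ < ι (suc m)
ι-suc-pos m = +-mono-<-≤ (positive⁻¹ 1ℚ) (ι-nonneg m)

ι-+ : ∀ m k → ι (m ℕ.+ k) ≡ ι m + ι k
ι-+ zero    k = sym (+-identityˡ (ι k))
ι-+ (suc m) k = trans (cong (1ℚ +_) (ι-+ m k)) (sym (+-assoc 1ℚ (ι m) (ι k)))

ι-mono-≤ : ∀ {m k} → m ℕ.≤ k → ι m ≤ ι k
ι-mono-≤ {k = k} ℕ.z≤n   = ι-nonneg k
ι-mono-≤ (ℕ.s≤s m≤k)     = +-monoʳ-≤ 1ℚ (ι-mono-≤ m≤k)

private
  ι-toℚᵘ : ∀ m → toℚᵘ (ι m) ℚᵘ.≃ ℚᵘ.mkℚᵘ (ℤ.+ m) 0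
  ι-toℚᵘ zero    = ℚᵘ.≃-refl
  ι-toℚᵘ (suc m) = begin
    toℚᵘ (1ℚ + ι m)                   ≈⟨ toℚᵘ-homo-+ 1ℚ (ι m) ⟩
    toℚᵘ 1ℚ ℚᵘ.+ toℚᵘ (ι m)           ≈⟨ ℚᵘ.+-congʳ (toℚᵘ 1ℚ) (ι-toℚᵘ m) ⟩
    toℚᵘ 1ℚ ℚᵘ.+ ℚᵘ.mkℚᵘ (ℤ.+ m) 0      ≈⟨ ℚᵘ.*≡* (cong (λ z → z ℤ.* ℤ.1ℤ) (cong (λ z → ℤ.1ℤ ℤ.+ z) (ℤ.*-identityʳ (ℤ.+ m)))) ⟩
    ℚᵘ.mkℚᵘ (ℤ.+ suc m) 0               ∎
    where open ℚᵘ.≃-Reasoning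

ι≡/1 : ∀ m → ι m ≡ ℤ.+ m / 1
ι≡/1 m = toℚᵘ-injective (ℚᵘ.≃-trans (ι-toℚᵘ m) (ℚᵘ.≃-sym (toℚᵘ-fromℚᵘ (ℚᵘ.mkℚᵘ (ℤ.+ m) 0))))

frac-*-suc : ∀ a b → frac a (suc b) * ι (suc b) ≡ ι a
frac-*-suc a b = toℚᵘ-injective (begin
  toℚᵘ (frac a (suc b) * ι (suc b))            ≈⟨ toℚᵘ-homo-* (frac a (suc b)) (ι (suc b)) ⟩
  toℚᵘ (frac a (suc b)) ℚᵘ.* toℚᵘ (ι (suc b))  ≈⟨ ℚᵘ.*-cong (toℚᵘ-fromℚᵘ (ℚᵘ.mkℚᵘ (ℤ.+ a) b)) (ι-toℚᵘ (suc b)) ⟩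
  ℚᵘ.mkℚᵘ (ℤ.+ a) b ℚᵘ.* ℚᵘ.mkℚᵘ (ℤ.+ suc b) 0     ≈⟨ ℚᵘ.*≡* (trans (ℤ.*-identityʳ _)
      (cong (λ z → (ℤ.+ a) ℤ.* (ℤ.+ z)) (sym (ℕ.*-identityʳ (suc b))))) ⟩
  ℚᵘ.mkℚᵘ (ℤ.+ a) 0                              ≈⟨ ι-toℚᵘ a ⟨
  toℚᵘ (ι a)                                   ∎)
  where open ℚᵘ.≃-Reasoning

-- If `b` is zero then so is `a`, hence the default value of `frac a 0` is harmless. This allows
-- norms to be used multiplied by their denominators, even when the total degree vanishes.
frac-* : ∀ {a b} → a ℕ.≤ b → frac a b * ι b ≡ ι a
frac-* {.zero} {zero} ℕ.z≤n = refl
frac-* {a} {suc b} _        = frac-*-suc a b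

frac-nonneg : ∀ a b → 0ℚ ≤ frac a b
frac-nonneg a zero    = ≤-refl
frac-nonneg a (suc b) = nonNegative⁻¹ (frac a (suc b)) {{normalize-nonNeg a (suc b)}}

ind : Bool → ℚ
ind true  = 1ℚ
ind false = 0ℚ

ind-nonneg : ∀ b → 0ℚ ≤ ind b
ind-nonneg true  = 0≤1
ind-nonneg false = ≤-refl

ind-∧ : ∀ a b → ind (a ∧ b) ≡ ind a * ind b
ind-∧ true  b = sym (*-identityˡ (ind b))
ind-∧ false b = sym (*-zeroˡ (ind b))

T⇒ind≡1 : ∀ {b} → T b → ind b ≡ 1ℚ
T⇒ind≡1 {true} _ = refl

ind-mono : ∀ {a b} → (T a → T b) → ind a ≤ ind b
ind-mono {false} {b}     _ = ind-nonneg b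
ind-mono {true}  {true}  _ = ≤-refl
ind-mono {true}  {false} f = ⊥-elim (f tt)

ind-cong : ∀ {a b} → (T a → T b) → (T b → T a) → ind a ≡ ind b
ind-cong f g = ≤-antisym (ind-mono f) (ind-mono g)

-- Under a sum, an equation is needed only where the indicator is 1. Size conditions and covering
-- relations enter later calculations in this way.
ind-*-cong : ∀ b → (T b → p ≡ q) → ind b * p ≡ ind b * q
ind-*-cong {p} {q} true  f = cong (1ℚ *_) (f tt)
ind-*-cong {p} {q} false f = trans (*-zeroˡ p) (sym (*-zeroˡ q))

ind-*-mono : ∀ b → (T b → p ≤ q) → ind b * p ≤ ind b * q
ind-*-mono {p} {q} true  f = *-monoˡ-≤ 0≤1 (f tt)
ind-*-mono {p} {q} false f = ≤-reflexive (trans (*-zeroˡ p) (sym (*-zeroˡ q)))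

ind-≤1 : ∀ b → ind b ≤ 1ℚ
ind-≤1 b = ind-mono {b} {true} _

ι-if : ∀ b m → ι (if b then m else 0) ≡ ind b * ι m
ι-if true  m = sym (*-identityˡ (ι m))
ι-if false m = sym (*-zeroˡ (ι m))

-- Opaque, so that unification can recover f from Σˢ f.
opaque

  Σˢ : (Subset n → ℚ) → ℚ
  Σˢ {zero}  f = f []
  Σˢ {suc n} f = Σˢ (λ σ → f (false ∷ σ)) + Σˢ (λ σ → f (true ∷ σ))

  Σ-cong : {f g : Subset n → ℚ} → (∀ σ → f σ ≡ g σ) → Σˢ f ≡ Σˢ g
  Σ-cong {zero}  h = h []
  Σ-cong {suc n} h = cong₂ _+_ (Σ-cong (h ∘ (false ∷_))) (Σ-cong (h ∘ (true ∷_)))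

  Σ-mono : {f g : Subset n → ℚ} → (∀ σ → f σ ≤ g σ) → Σˢ f ≤ Σˢ g
  Σ-mono {zero}  h = h []
  Σ-mono {suc n} h = +-mono-≤ (Σ-mono (h ∘ (false ∷_))) (Σ-mono (h ∘ (true ∷_)))

  Σ-0 : Σˢ {n} (λ _ → 0ℚ) ≡ 0ℚ
  Σ-0 {zero}  = refl
  Σ-0 {suc n} = cong₂ _+_ (Σ-0 {n}) (Σ-0 {n})

  Σ-zero : {f : Subset n → ℚ} → (∀ σ → f σ ≡ 0ℚ) → Σˢ f ≡ 0ℚ
  Σ-zero {n} h = trans (Σ-cong h) (Σ-0 {n})

  Σ-nonneg : {f : Subset n → ℚ} → (∀ σ → 0ℚ ≤ f σ) → 0ℚ ≤ Σˢ f
  Σ-nonneg {n} {f} h = subst (_≤ Σˢ f) (Σ-0 {n}) (Σ-mono h)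

  Σ-+ : (f g : Subset n → ℚ) → Σˢ (λ σ → f σ + g σ) ≡ Σˢ f + Σˢ g
  Σ-+ {zero}  f g = refl
  Σ-+ {suc n} f g = trans (cong₂ _+_ (Σ-+ (f ∘ (false ∷_)) (g ∘ (false ∷_))) (Σ-+ (f ∘ (true ∷_)) (g ∘ (true ∷_))))
    (solve 4 (λ a b c d → (a :+ b) :+ (c :+ d) := (a :+ c) :+ (b :+ d)) refl
      (Σˢ (f ∘ (false ∷_))) (Σˢ (g ∘ (false ∷_))) (Σˢ (f ∘ (true ∷_))) (Σˢ (g ∘ (true ∷_))))

  Σ-*ˡ : ∀ c (f : Subset n → ℚ) → Σˢ (λ σ → c * f σ) ≡ c * Σˢ f
  Σ-*ˡ {zero}  c f = refl
  Σ-*ˡ {suc n} c f = trans (cong₂ _+_ (Σ-*ˡ c (f ∘ (false ∷_))) (Σ-*ˡ c (f ∘ (true ∷_))))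
    (sym (*-distribˡ-+ c (Σˢ (f ∘ (false ∷_))) (Σˢ (f ∘ (true ∷_)))))

  Σ-*ʳ : ∀ (f : Subset n → ℚ) c → Σˢ (λ σ → f σ * c) ≡ Σˢ f * c
  Σ-*ʳ f c = trans (Σ-cong (λ σ → *-comm (f σ) c)) (trans (Σ-*ˡ c f) (*-comm c (Σˢ f)))

  Σ-swap : ∀ {m} (f : Subset m → Subset n → ℚ) → Σˢ (λ σ → Σˢ (f σ)) ≡ Σˢ (λ τ → Σˢ (λ σ → f σ τ))
  Σ-swap {m = zero}  f = refl
  Σ-swap {m = suc m} f = trans
    (cong₂ _+_ (Σ-swap (f ∘ (false ∷_))) (Σ-swap (f ∘ (true ∷_))))
    (sym (Σ-+ (λ τ → Σˢ (λ σ → f (false ∷ σ) τ)) (λ τ → Σˢ (λ σ → f (true ∷ σ) τ))))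

  term≤Σ : {f : Subset n → ℚ} → (∀ σ → 0ℚ ≤ f σ) → ∀ σ → f σ ≤ Σˢ f
  term≤Σ h [] = ≤-refl
  term≤Σ {suc n} {f} h (false ∷ σ) = ≤-trans (term≤Σ (h ∘ (false ∷_)) σ)
    (≤-by-difference refl (Σ-nonneg (h ∘ (true ∷_))))
  term≤Σ {suc n} {f} h (true ∷ σ) = ≤-trans (term≤Σ (h ∘ (true ∷_)) σ)
    (≤-by-difference (+-comm (Σˢ (f ∘ (false ∷_))) (Σˢ (f ∘ (true ∷_)))) (Σ-nonneg (h ∘ (false ∷_))))

  ι-sum : ∀ n (f : Subset n → ℕ) → ι (sum (map f (allSubsets n))) ≡ Σˢ (ι ∘ f)
  ι-sum zero    f = trans (ι-+ (f []) 0) (+-identityʳ (ι (f [])))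
  ι-sum (suc n) f = begin
    ι (sum (map f (map (false ∷_) xs ++ map (true ∷_) xs)))
      ≡⟨ cong (ι ∘ sum) (map-++ f (map (false ∷_) xs) (map (true ∷_) xs)) ⟩
    ι (sum (map f (map (false ∷_) xs) ++ map f (map (true ∷_) xs)))
      ≡⟨ cong ι (sum-++ (map f (map (false ∷_) xs)) (map f (map (true ∷_) xs))) ⟩
    ι (sum (map f (map (false ∷_) xs)) ℕ.+ sum (map f (map (true ∷_) xs)))
      ≡⟨ ι-+ (sum (map f (map (false ∷_) xs))) (sum (map f (map (true ∷_) xs))) ⟩
    ι (sum (map f (map (false ∷_) xs))) + ι (sum (map f (map (true ∷_) xs)))
      ≡⟨ cong₂ (λ a b → ι (sum a) + ι (sum b)) (map-∘ xs) (map-∘ xs) ⟨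
    ι (sum (map (f ∘ (false ∷_)) xs)) + ι (sum (map (f ∘ (true ∷_)) xs))
      ≡⟨ cong₂ _+_ (ι-sum n (f ∘ (false ∷_))) (ι-sum n (f ∘ (true ∷_))) ⟩
    Σˢ (ι ∘ f) ∎
    where
    open ≡-Reasoning
    xs : List (Subset n)
    xs = allSubsets n

-- Subsets and covering pairs

T-∧⁻ : ∀ {a b} → T (a ∧ b) → T a × T b
T-∧⁻ = Equivalence.to T-∧

T-∧⁺ : ∀ {a b} → T a → T b → T (a ∧ b)
T-∧⁺ ta tb = Equivalence.from T-∧ (ta , tb)

⊆ᵇ⇒⊆ : (σ τ : Subset n) → T (σ ⊆ᵇ τ) → σ ⊆ τ
⊆ᵇ⇒⊆ (false ∷ σ) (b ∷ τ)    h (there x∈σ) = there (⊆ᵇ⇒⊆ σ τ h x∈σ)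
⊆ᵇ⇒⊆ (true ∷ σ)  (true ∷ τ) h here        = here
⊆ᵇ⇒⊆ (true ∷ σ)  (true ∷ τ) h (there x∈σ) = there (⊆ᵇ⇒⊆ σ τ h x∈σ)

⊆⇒⊆ᵇ : (σ τ : Subset n) → σ ⊆ τ → T (σ ⊆ᵇ τ)
⊆⇒⊆ᵇ []          []          h = tt
⊆⇒⊆ᵇ (false ∷ σ) (b ∷ τ)     h = ⊆⇒⊆ᵇ σ τ (drop-∷-⊆ h)
⊆⇒⊆ᵇ (true ∷ σ)  (true ∷ τ)  h = ⊆⇒⊆ᵇ σ τ (drop-∷-⊆ h)
⊆⇒⊆ᵇ (true ∷ σ)  (false ∷ τ) h with () ← h here

⊆ᵇ-trans : (ρ σ τ : Subset n) → T (ρ ⊆ᵇ σ) → T (σ ⊆ᵇ τ) → T (ρ ⊆ᵇ τ)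
⊆ᵇ-trans ρ σ τ h k = ⊆⇒⊆ᵇ ρ τ (⊆-trans (⊆ᵇ⇒⊆ ρ σ h) (⊆ᵇ⇒⊆ σ τ k))

⊆ᵇ⇒∣∣≤ : (σ τ : Subset n) → T (σ ⊆ᵇ τ) → ∣ σ ∣ ℕ.≤ ∣ τ ∣
⊆ᵇ⇒∣∣≤ σ τ h = p⊆q⇒∣p∣≤∣q∣ (⊆ᵇ⇒⊆ σ τ h)

⊈ᵇ⇒witness : (σ τ : Subset n) → ¬ T (σ ⊆ᵇ τ) → ∃ λ x → x ∈ σ × x ∉ τ
⊈ᵇ⇒witness []          []          h = ⊥-elim (h tt)
⊈ᵇ⇒witness (false ∷ σ) (b ∷ τ)     h =
  let x , x∈σ , x∉τ = ⊈ᵇ⇒witness σ τ h in suc x , there x∈σ , x∉τ ∘ drop-there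
⊈ᵇ⇒witness (true ∷ σ)  (true ∷ τ)  h =
  let x , x∈σ , x∉τ = ⊈ᵇ⇒witness σ τ h in suc x , there x∈σ , x∉τ ∘ drop-there
⊈ᵇ⇒witness (true ∷ σ)  (false ∷ τ) h = zero , here , λ ()

∣∣≡0⇒∅ : (σ : Subset n) → ∣ σ ∣ ≡ 0 → σ ≡ ∅
∣∣≡0⇒∅ []          _ = refl
∣∣≡0⇒∅ (false ∷ σ) h = cong (false ∷_) (∣∣≡0⇒∅ σ h)

∣∅∣≡0 : ∀ n → ∣ ∅ {n} ∣ ≡ 0
∣∅∣≡0 zero    = refl
∣∅∣≡0 (suc n) = ∣∅∣≡0 n

∣∣≡1⇒singleton : (ρ : Subset n) → ∣ ρ ∣ ≡ 1 → ∃ λ x → ρ ≡ ⁅ x ⁆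
∣∣≡1⇒singleton (false ∷ ρ) h = let x , ρ≡ = ∣∣≡1⇒singleton ρ h in suc x , cong (false ∷_) ρ≡
∣∣≡1⇒singleton (true ∷ ρ)  h = zero , cong (true ∷_) (∣∣≡0⇒∅ ρ (ℕ.suc-injective h))

disjoint⇒∉ : (ρ σ : Subset n) → T (disjointᵇ ρ σ) → ∀ {x} → x ∈ ρ → x ∉ σ
disjoint⇒∉ (true ∷ ρ) (false ∷ σ) h here ()
disjoint⇒∉ (a ∷ ρ) (b ∷ σ) h (there x∈ρ) (there x∈σ) = disjoint⇒∉ ρ σ (proj₂ (T-∧⁻ {not (a ∧ b)} h)) x∈ρ x∈σ

∉⇒disjoint : (ρ σ : Subset n) → (∀ {x} → x ∈ ρ → x ∉ σ) → T (disjointᵇ ρ σ)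
∉⇒disjoint []          []          h = tt
∉⇒disjoint (true ∷ ρ)  (true ∷ σ)  h = h here here
∉⇒disjoint (true ∷ ρ)  (false ∷ σ) h = ∉⇒disjoint ρ σ (λ x∈ρ x∈σ → h (there x∈ρ) (there x∈σ))
∉⇒disjoint (false ∷ ρ) (b ∷ σ)     h = ∉⇒disjoint ρ σ (λ x∈ρ x∈σ → h (there x∈ρ) (there x∈σ))

∣∪∣-disjoint : (ρ σ : Subset n) → T (disjointᵇ ρ σ) → ∣ ρ ∪ σ ∣ ≡ ∣ ρ ∣ ℕ.+ ∣ σ ∣
∣∪∣-disjoint []          []          h = refl
∣∪∣-disjoint (false ∷ ρ) (false ∷ σ) h = ∣∪∣-disjoint ρ σ h
∣∪∣-disjoint (false ∷ ρ) (true ∷ σ)  h = trans (cong suc (∣∪∣-disjoint ρ σ h)) (sym (ℕ.+-suc ∣ ρ ∣ ∣ σ ∣))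
∣∪∣-disjoint (true ∷ ρ)  (false ∷ σ) h = cong suc (∣∪∣-disjoint ρ σ h)

opaque
  unfolding Σˢ

  -- A subset disjoint from σ corresponds to the superset of σ obtained by adding σ to it.
  Σ-disjoint≡Σ-superset : (σ : Subset n) (h : Subset n → Subset n → ℚ) →
    Σˢ (λ ρ → ind (disjointᵇ ρ σ) * h ρ (ρ ∪ σ)) ≡ Σˢ (λ κ → ind (σ ⊆ᵇ κ) * h (κ ─ σ) κ)
  Σ-disjoint≡Σ-superset []          h = refl
  Σ-disjoint≡Σ-superset (false ∷ σ) h = cong₂ _+_
    (Σ-disjoint≡Σ-superset σ (λ ρ κ → h (false ∷ ρ) (false ∷ κ)))
    (Σ-disjoint≡Σ-superset σ (λ ρ κ → h (true ∷ ρ) (true ∷ κ)))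
  -- The first vertex lies in `σ`: it is absent from every disjoint set and present in every
  -- superset, so one half of each sum vanishes.
  Σ-disjoint≡Σ-superset (true ∷ σ) h = begin
    Σˢ (λ ρ → ind (disjointᵇ ρ σ) * h (false ∷ ρ) (true ∷ (ρ ∪ σ))) + Σˢ (λ ρ → 0ℚ * h (true ∷ ρ) (true ∷ (ρ ∪ σ)))
      ≡⟨ cong₂ _+_ (Σ-disjoint≡Σ-superset σ (λ ρ κ → h (false ∷ ρ) (true ∷ κ))) (Σ-zero (λ ρ → *-zeroˡ (h (true ∷ ρ) (true ∷ (ρ ∪ σ))))) ⟩
    B + 0ℚ
      ≡⟨ +-comm B 0ℚ ⟩
    0ℚ + B
      ≡⟨ cong (_+ B) (Σ-zero (λ κ → *-zeroˡ (h (false ∷ (κ ─ σ)) (false ∷ κ)))) ⟨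
    Σˢ (λ κ → 0ℚ * h (false ∷ (κ ─ σ)) (false ∷ κ)) + B ∎
    where
    open ≡-Reasoning
    B : ℚ
    B = Σˢ (λ κ → ind (σ ⊆ᵇ κ) * h (false ∷ (κ ─ σ)) (true ∷ κ))

_⋖ᵇ_ : Subset n → Subset n → Bool
σ ⋖ᵇ τ = (σ ⊆ᵇ τ) ∧ (∣ τ ∣ ≡ᵇ suc ∣ σ ∣)

cov : Subset n → Subset n → ℚ
cov σ τ = ind (σ ⋖ᵇ τ)

cov-nonneg : (σ τ : Subset n) → 0ℚ ≤ cov σ τ
cov-nonneg σ τ = ind-nonneg (σ ⋖ᵇ τ)

⋖⇒⊆ : (σ τ : Subset n) → T (σ ⋖ᵇ τ) → T (σ ⊆ᵇ τ)
⋖⇒⊆ σ τ h = proj₁ (T-∧⁻ h)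

⋖⇒∣∣ : (σ τ : Subset n) → T (σ ⋖ᵇ τ) → ∣ τ ∣ ≡ suc ∣ σ ∣
⋖⇒∣∣ σ τ h = ℕ.≡ᵇ⇒≡ ∣ τ ∣ (suc ∣ σ ∣) (proj₂ (T-∧⁻ {σ ⊆ᵇ τ} h))

⋖-intro : (σ τ : Subset n) → T (σ ⊆ᵇ τ) → ∣ τ ∣ ≡ suc ∣ σ ∣ → T (σ ⋖ᵇ τ)
⋖-intro σ τ h e = T-∧⁺ h (ℕ.≡⇒≡ᵇ ∣ τ ∣ (suc ∣ σ ∣) e)

ind≡0 : ∀ {b} → ¬ T b → ind b ≡ 0ℚ
ind≡0 {false} _ = refl
ind≡0 {true}  h = ⊥-elim (h tt)

too-big : (σ τ : Subset n) → ¬ T ((σ ⊆ᵇ τ) ∧ (suc ∣ τ ∣ ≡ᵇ ∣ σ ∣))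
too-big σ τ h = let a , b = T-∧⁻ {σ ⊆ᵇ τ} h in
  ℕ.1+n≰n (subst (ℕ._≤ ∣ τ ∣) (sym (ℕ.≡ᵇ⇒≡ (suc ∣ τ ∣) ∣ σ ∣ b)) (⊆ᵇ⇒∣∣≤ σ τ a))

opaque
  unfolding Σˢ

  -- The only term that survives is `τ` itself. This is what remains of a covering pair once the
  -- removed vertex has been met.
  Σ-equal-size-below : (τ : Subset n) → Σˢ (λ σ → ind ((σ ⊆ᵇ τ) ∧ (∣ τ ∣ ≡ᵇ ∣ σ ∣))) ≡ 1ℚ
  Σ-equal-size-below []          = refl
  Σ-equal-size-below {suc n} (false ∷ τ) = trans (cong₂ _+_ (Σ-equal-size-below τ) (Σ-0 {n})) (+-identityʳ 1ℚ)
  Σ-equal-size-below (true ∷ τ)  = trans (cong₂ _+_ (Σ-zero (λ σ → ind≡0 (too-big σ τ))) (Σ-equal-size-below τ)) (+-identityˡ 1ℚ)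

  -- There is one facet for each removable vertex. For a first vertex in `τ`, either it is the
  -- removed one and the tails agree, or the removal happens in the tail.
  Σ-cov-below : (τ : Subset n) → Σˢ (λ σ → cov σ τ) ≡ ι ∣ τ ∣
  Σ-cov-below []          = refl
  Σ-cov-below {suc n} (false ∷ τ) = trans (cong₂ _+_ (Σ-cov-below τ) (Σ-0 {n})) (+-identityʳ _)
  Σ-cov-below (true ∷ τ)  = cong₂ _+_ (Σ-equal-size-below τ) (Σ-cov-below τ)

  Σ-equal-size-above : (σ : Subset n) (f : Subset n → ℚ) →
    Σˢ (λ τ → ind ((σ ⊆ᵇ τ) ∧ (∣ τ ∣ ≡ᵇ ∣ σ ∣)) * f τ) ≡ f σ
  Σ-equal-size-above []          f = *-identityˡ (f [])
  Σ-equal-size-above (false ∷ σ) f = trans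
    (cong₂ _+_ (Σ-equal-size-above σ (f ∘ (false ∷_)))
      (Σ-zero (λ τ → trans (cong (_* f (true ∷ τ)) (ind≡0 (too-big σ τ))) (*-zeroˡ (f (true ∷ τ))))))
    (+-identityʳ _)
  Σ-equal-size-above (true ∷ σ) f = trans
    (cong₂ _+_ (Σ-zero (λ τ → *-zeroˡ (f (false ∷ τ)))) (Σ-equal-size-above σ (f ∘ (true ∷_))))
    (+-identityˡ _)

  -- The intermediate sets arise by adding to `σ` one of the vertices of `κ` outside it. If `σ` is
  -- not contained in `κ`, both sides vanish.
  Σ-cov-above : (σ κ : Subset n) →
    Σˢ (λ τ → cov σ τ * ind (τ ⊆ᵇ κ)) ≡ ι (∣ κ ∣ ∸ ∣ σ ∣) * ind (σ ⊆ᵇ κ)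
  Σ-cov-above []          []          = refl
  Σ-cov-above (false ∷ σ) (false ∷ κ) = trans
    (cong₂ _+_ (Σ-cov-above σ κ) (Σ-zero (λ τ → *-zeroʳ (cov (false ∷ σ) (true ∷ τ)))))
    (+-identityʳ _)
  Σ-cov-above (false ∷ σ) (true ∷ κ) = begin
    Σˢ (λ τ → cov σ τ * ind (τ ⊆ᵇ κ)) + Σˢ (λ τ → ind ((σ ⊆ᵇ τ) ∧ (∣ τ ∣ ≡ᵇ ∣ σ ∣)) * ind (τ ⊆ᵇ κ))
      ≡⟨ cong₂ _+_ (Σ-cov-above σ κ) (Σ-equal-size-above σ (λ τ → ind (τ ⊆ᵇ κ))) ⟩
    ι (∣ κ ∣ ∸ ∣ σ ∣) * ind (σ ⊆ᵇ κ) + ind (σ ⊆ᵇ κ)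
      ≡⟨ solve 2 (λ a b → a :* b :+ b := b :* (con 1ℚ :+ a)) refl (ι (∣ κ ∣ ∸ ∣ σ ∣)) (ind (σ ⊆ᵇ κ)) ⟩
    ind (σ ⊆ᵇ κ) * (1ℚ + ι (∣ κ ∣ ∸ ∣ σ ∣))
      -- A successor moves into the truncated subtraction only when `∣ σ ∣ ≤ ∣ κ ∣`, which the
      -- indicator supplies.
      ≡⟨ ind-*-cong (σ ⊆ᵇ κ) (λ h → cong ι (sym (ℕ.+-∸-assoc 1 (⊆ᵇ⇒∣∣≤ σ κ h)))) ⟩
    ind (σ ⊆ᵇ κ) * ι (suc ∣ κ ∣ ∸ ∣ σ ∣)
      ≡⟨ *-comm (ind (σ ⊆ᵇ κ)) _ ⟩
    ι (suc ∣ κ ∣ ∸ ∣ σ ∣) * ind (σ ⊆ᵇ κ) ∎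
    where open ≡-Reasoning
  Σ-cov-above (true ∷ σ) (false ∷ κ) = trans
    (cong₂ _+_ (Σ-zero (λ τ → *-zeroˡ (ind (τ ⊆ᵇ κ)))) (Σ-zero (λ τ → *-zeroʳ (cov (true ∷ σ) (true ∷ τ)))))
    (sym (*-zeroʳ (ι (∣ κ ∣ ∸ suc ∣ σ ∣))))
  Σ-cov-above (true ∷ σ) (true ∷ κ) = trans
    (cong₂ _+_ (Σ-zero (λ τ → *-zeroˡ (ind (τ ⊆ᵇ κ)))) (Σ-cov-above σ κ))
    (+-identityˡ _)

-- Both of the faces strictly between σ and κ are counted, hence the factor 2.
Σ-cov-cov : (σ κ : Subset n) →
  Σˢ (λ τ → cov σ τ * cov τ κ) ≡ ι 2 * (ind (σ ⊆ᵇ κ) * ind (∣ κ ∣ ≡ᵇ suc (suc ∣ σ ∣)))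
Σ-cov-cov σ κ = begin
  Σˢ (λ τ → cov σ τ * cov τ κ)
    ≡⟨ Σ-cong (λ τ → trans
         (ind-*-cong (σ ⋖ᵇ τ) λ h → trans (cong (λ k → ind ((τ ⊆ᵇ κ) ∧ (∣ κ ∣ ≡ᵇ suc k))) (⋖⇒∣∣ σ τ h)) (ind-∧ (τ ⊆ᵇ κ) e))
         (sym (*-assoc (cov σ τ) (ind (τ ⊆ᵇ κ)) (ind e)))) ⟩
  Σˢ (λ τ → cov σ τ * ind (τ ⊆ᵇ κ) * ind e)
    ≡⟨ Σ-*ʳ (λ τ → cov σ τ * ind (τ ⊆ᵇ κ)) (ind e) ⟩
  Σˢ (λ τ → cov σ τ * ind (τ ⊆ᵇ κ)) * ind e
    ≡⟨ cong (_* ind e) (Σ-cov-above σ κ) ⟩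
  ι (∣ κ ∣ ∸ ∣ σ ∣) * ind (σ ⊆ᵇ κ) * ind e
    ≡⟨ *-comm (ι (∣ κ ∣ ∸ ∣ σ ∣) * ind (σ ⊆ᵇ κ)) (ind e) ⟩
  ind e * (ι (∣ κ ∣ ∸ ∣ σ ∣) * ind (σ ⊆ᵇ κ))
    ≡⟨ ind-*-cong e (λ h → cong (λ k → ι k * ind (σ ⊆ᵇ κ)) (trans (cong (_∸ ∣ σ ∣) (ℕ.≡ᵇ⇒≡ ∣ κ ∣ _ h)) (ℕ.m+n∸n≡m 2 ∣ σ ∣))) ⟩
  ind e * (ι 2 * ind (σ ⊆ᵇ κ))
    ≡⟨ solve 3 (λ a b c → a :* (b :* c) := b :* (c :* a)) refl (ind e) (ι 2) (ind (σ ⊆ᵇ κ)) ⟩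
  ι 2 * (ind (σ ⊆ᵇ κ) * ind e) ∎
  where
  open ≡-Reasoning
  e = ∣ κ ∣ ≡ᵇ suc (suc ∣ σ ∣)

-- Degrees as weights

-- Here `k` counts vertices, so dimension `i` is level `suc i`. All subsets take part; membership in
-- the complex comes from weights that vanish off it.
lev : ℕ → (Subset n → ℚ) → ℚ
lev k f = Σˢ (λ σ → ind (∣ σ ∣ ≡ᵇ k) * f σ)

up : Subset n → (Subset n → ℚ) → ℚ
up σ f = Σˢ (λ τ → cov σ τ * f τ)

down : Subset n → (Subset n → ℚ) → ℚ
down τ f = Σˢ (λ σ → cov σ τ * f σ)

lev-cong : ∀ k {f g : Subset n → ℚ} → (∀ σ → ∣ σ ∣ ≡ k → f σ ≡ g σ) → lev k f ≡ lev k g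
lev-cong k h = Σ-cong (λ σ → ind-*-cong (∣ σ ∣ ≡ᵇ k) (λ e → h σ (ℕ.≡ᵇ⇒≡ ∣ σ ∣ k e)))

lev-mono : ∀ k {f g : Subset n → ℚ} → (∀ σ → ∣ σ ∣ ≡ k → f σ ≤ g σ) → lev k f ≤ lev k g
lev-mono k h = Σ-mono (λ σ → ind-*-mono (∣ σ ∣ ≡ᵇ k) (λ e → h σ (ℕ.≡ᵇ⇒≡ ∣ σ ∣ k e)))

up-cong : ∀ (σ : Subset n) {f g} → (∀ τ → T (σ ⋖ᵇ τ) → f τ ≡ g τ) → up σ f ≡ up σ g
up-cong σ h = Σ-cong (λ τ → ind-*-cong (σ ⋖ᵇ τ) (h τ))

up-mono : ∀ (σ : Subset n) {f g} → (∀ τ → T (σ ⋖ᵇ τ) → f τ ≤ g τ) → up σ f ≤ up σ g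
up-mono σ h = Σ-mono (λ τ → ind-*-mono (σ ⋖ᵇ τ) (h τ))

*-swap : ∀ a b c → a * (b * c) ≡ b * (a * c)
*-swap = solve 3 (λ a b c → a :* (b :* c) := b :* (a :* c)) refl

lev-* : ∀ k c (f : Subset n → ℚ) → lev k (λ σ → c * f σ) ≡ c * lev k f
lev-* k c f = trans (Σ-cong (λ σ → *-swap (ind (∣ σ ∣ ≡ᵇ k)) c (f σ))) (Σ-*ˡ c _)

up-* : ∀ (σ : Subset n) c f → up σ (λ τ → c * f τ) ≡ c * up σ f
up-* σ c f = trans (Σ-cong (λ τ → *-swap (cov σ τ) c (f τ))) (Σ-*ˡ c _)

lev-+ : ∀ k (f g : Subset n → ℚ) → lev k (λ σ → f σ + g σ) ≡ lev k f + lev k g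
lev-+ k f g = trans (Σ-cong (λ σ → *-distribˡ-+ (ind (∣ σ ∣ ≡ᵇ k)) (f σ) (g σ))) (Σ-+ _ _)

up-+ : ∀ (σ : Subset n) f g → up σ (λ τ → f τ + g τ) ≡ up σ f + up σ g
up-+ σ f g = trans (Σ-cong (λ τ → *-distribˡ-+ (cov σ τ) (f τ) (g τ))) (Σ-+ _ _)

lev-nonneg : ∀ k {f : Subset n → ℚ} → (∀ σ → 0ℚ ≤ f σ) → 0ℚ ≤ lev k f
lev-nonneg k h = Σ-nonneg (λ σ → *-nonneg (ind-nonneg (∣ σ ∣ ≡ᵇ k)) (h σ))

up-nonneg : ∀ (σ : Subset n) {f} → (∀ τ → 0ℚ ≤ f τ) → 0ℚ ≤ up σ f
up-nonneg σ h = Σ-nonneg (λ τ → *-nonneg (cov-nonneg σ τ) (h τ))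

down-const : ∀ (τ : Subset n) c → down τ (λ _ → c) ≡ ι ∣ τ ∣ * c
down-const τ c = trans (Σ-*ʳ (λ σ → cov σ τ) c) (cong (_* c) (Σ-cov-below τ))

term≤down : ∀ (σ τ : Subset n) {f} → (∀ σ → 0ℚ ≤ f σ) → T (σ ⋖ᵇ τ) → f σ ≤ down τ f
term≤down σ τ {f} h c = begin
  f σ            ≡⟨ *-identityˡ (f σ) ⟨
  1ℚ * f σ       ≡⟨ cong (_* f σ) (T⇒ind≡1 c) ⟨
  cov σ τ * f σ  ≤⟨ term≤Σ (λ ρ → *-nonneg (cov-nonneg ρ τ) (h ρ)) σ ⟩
  down τ f       ∎
  where open ≤-Reasoning

-- Double counting of covering pairs: on such a pair, the size of either member determines the size
-- of the other.
lev-up≡lev-down : ∀ k (g : Subset n → Subset n → ℚ) →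
  lev k (λ σ → up σ (g σ)) ≡ lev (suc k) (λ τ → down τ (λ σ → g σ τ))
lev-up≡lev-down k g = begin
  Σˢ (λ σ → ind (∣ σ ∣ ≡ᵇ k) * up σ (g σ))
    ≡⟨ Σ-cong (λ σ → sym (Σ-*ˡ (ind (∣ σ ∣ ≡ᵇ k)) _)) ⟩
  Σˢ (λ σ → Σˢ (λ τ → ind (∣ σ ∣ ≡ᵇ k) * (cov σ τ * g σ τ)))
    ≡⟨ Σ-swap _ ⟩
  Σˢ (λ τ → Σˢ (λ σ → ind (∣ σ ∣ ≡ᵇ k) * (cov σ τ * g σ τ)))
    ≡⟨ Σ-cong (λ τ → Σ-cong (λ σ → shift σ τ)) ⟩
  Σˢ (λ τ → Σˢ (λ σ → ind (∣ τ ∣ ≡ᵇ suc k) * (cov σ τ * g σ τ)))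
    ≡⟨ Σ-cong (λ τ → Σ-*ˡ (ind (∣ τ ∣ ≡ᵇ suc k)) _) ⟩
  Σˢ (λ τ → ind (∣ τ ∣ ≡ᵇ suc k) * down τ (λ σ → g σ τ)) ∎
  where
  open ≡-Reasoning
  shift : ∀ σ τ → ind (∣ σ ∣ ≡ᵇ k) * (cov σ τ * g σ τ) ≡ ind (∣ τ ∣ ≡ᵇ suc k) * (cov σ τ * g σ τ)
  shift σ τ = begin
    ind (∣ σ ∣ ≡ᵇ k) * (cov σ τ * g σ τ)
      ≡⟨ *-swap (ind (∣ σ ∣ ≡ᵇ k)) (cov σ τ) (g σ τ) ⟩
    cov σ τ * (ind (∣ σ ∣ ≡ᵇ k) * g σ τ)
      ≡⟨ ind-*-cong (σ ⋖ᵇ τ) (λ c → cong (λ m → ind (m ≡ᵇ suc k) * g σ τ) (sym (⋖⇒∣∣ σ τ c))) ⟩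
    cov σ τ * (ind (∣ τ ∣ ≡ᵇ suc k) * g σ τ)
      ≡⟨ *-swap (cov σ τ) (ind (∣ τ ∣ ≡ᵇ suc k)) (g σ τ) ⟩
    ind (∣ τ ∣ ≡ᵇ suc k) * (cov σ τ * g σ τ) ∎

lev-up : ∀ k (f : Subset n → ℚ) → lev k (λ σ → up σ f) ≡ ι (suc k) * lev (suc k) f
lev-up k f = trans (lev-up≡lev-down k (λ _ → f)) (trans
  (lev-cong (suc k) (λ τ e → trans (down-const τ (f τ)) (cong (λ m → ι m * f τ) e)))
  (lev-* (suc k) (ι (suc k)) f))

opaque
  unfolding Σˢ

  lev-zero : (f : Subset n → ℚ) → lev 0 f ≡ f ∅
  lev-zero {zero}  f = *-identityˡ (f [])
  lev-zero {suc n} f = trans (cong₂ _+_ (lev-zero (f ∘ (false ∷_))) (Σ-zero (λ σ → *-zeroˡ (f (true ∷ σ))))) (+-identityʳ _)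

-- Seen in the link of `σ`, the iterated sum visits an edge through each of its two endpoints.
up-up : ∀ (σ : Subset n) f →
  up σ (λ τ → up τ f) ≡ ι 2 * Σˢ (λ κ → ind (σ ⊆ᵇ κ) * (ind (∣ κ ∣ ≡ᵇ suc (suc ∣ σ ∣)) * f κ))
up-up σ f = begin
  Σˢ (λ τ → cov σ τ * up τ f)
    ≡⟨ Σ-cong (λ τ → sym (Σ-*ˡ (cov σ τ) _)) ⟩
  Σˢ (λ τ → Σˢ (λ κ → cov σ τ * (cov τ κ * f κ)))
    ≡⟨ Σ-swap _ ⟩
  Σˢ (λ κ → Σˢ (λ τ → cov σ τ * (cov τ κ * f κ)))
    ≡⟨ Σ-cong (λ κ → Σ-cong (λ τ → sym (*-assoc (cov σ τ) (cov τ κ) (f κ)))) ⟩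
  Σˢ (λ κ → Σˢ (λ τ → cov σ τ * cov τ κ * f κ))
    ≡⟨ Σ-cong (λ κ → trans (Σ-*ʳ (λ τ → cov σ τ * cov τ κ) (f κ)) (cong (_* f κ) (Σ-cov-cov σ κ))) ⟩
  Σˢ (λ κ → ι 2 * (ind (σ ⊆ᵇ κ) * ind (∣ κ ∣ ≡ᵇ suc (suc ∣ σ ∣))) * f κ)
    ≡⟨ Σ-cong (λ κ → solve 4 (λ t a b c → t :* (a :* b) :* c := t :* (a :* (b :* c))) refl
                       (ι 2) (ind (σ ⊆ᵇ κ)) (ind (∣ κ ∣ ≡ᵇ suc (suc ∣ σ ∣))) (f κ)) ⟩
  Σˢ (λ κ → ι 2 * (ind (σ ⊆ᵇ κ) * (ind (∣ κ ∣ ≡ᵇ suc (suc ∣ σ ∣)) * f κ)))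
    ≡⟨ Σ-*ˡ (ι 2) _ ⟩
  ι 2 * Σˢ (λ κ → ind (σ ⊆ᵇ κ) * (ind (∣ κ ∣ ≡ᵇ suc (suc ∣ σ ∣)) * f κ)) ∎
  where open ≡-Reasoning

up-as-Σ : ∀ (σ : Subset n) f → up σ f ≡ Σˢ (λ κ → ind (σ ⊆ᵇ κ) * (ind (∣ κ ∣ ≡ᵇ suc ∣ σ ∣) * f κ))
up-as-Σ σ f = Σ-cong (λ κ → trans (cong (_* f κ) (ind-∧ (σ ⊆ᵇ κ) _)) (*-assoc (ind (σ ⊆ᵇ κ)) (ind (∣ κ ∣ ≡ᵇ suc ∣ σ ∣)) (f κ)))

sum-map-mono : {A : Set} {f g : A → ℕ} → (∀ x → f x ℕ.≤ g x) → ∀ xs → sum (map f xs) ℕ.≤ sum (map g xs)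
sum-map-mono h []       = ℕ.z≤n
sum-map-mono h (x ∷ xs) = ℕ.+-mono-≤ (h x) (sum-map-mono h xs)

degSum-≤-total : ∀ (X : Family n) D i P → degSum X D i P ℕ.≤ degSum X D i (λ _ → true)
degSum-≤-total {n} X D i P = sum-map-mono (λ σ → lem (P σ) (X σ ∧ (∣ σ ∣ ≡ᵇ suc i)) (deg X D σ)) (allSubsets n)
  where
  lem : ∀ a b m → (if a ∧ b then m else 0) ℕ.≤ (if b then m else 0)
  lem true  b m = ℕ.≤-refl
  lem false b m = ℕ.z≤n

norm-* : ∀ (X : Family n) D i P → norm X D i P * ι (degSum X D i (λ _ → true)) ≡ ι (degSum X D i P)
norm-* X D i P = frac-* (degSum-≤-total X D i P)

ι-degSum : ∀ (X : Family n) D i P →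
  ι (degSum X D i P) ≡ Σˢ (λ σ → ind (X σ) * (ind (∣ σ ∣ ≡ᵇ suc i) * (ind (P σ) * ι (deg X D σ))))
ι-degSum {n} X D i P = trans (ι-sum n _) (Σ-cong step)
  where
  step : ∀ σ → ι (if P σ ∧ X σ ∧ (∣ σ ∣ ≡ᵇ suc i) then deg X D σ else 0) ≡
               ind (X σ) * (ind (∣ σ ∣ ≡ᵇ suc i) * (ind (P σ) * ι (deg X D σ)))
  step σ = trans (ι-if (P σ ∧ X σ ∧ (∣ σ ∣ ≡ᵇ suc i)) (deg X D σ))
    (trans (cong (_* ι (deg X D σ)) (trans (ind-∧ (P σ) _) (cong (ind (P σ) *_) (ind-∧ (X σ) _))))
      (solve 4 (λ a b c e → (a :* (b :* c)) :* e := b :* (c :* (a :* e))) refl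
        (ind (P σ)) (ind (X σ)) (ind (∣ σ ∣ ≡ᵇ suc i)) (ι (deg X D σ))))

ι-deg : ∀ (X : Family n) D σ →
  ι (deg X D σ) ≡ Σˢ (λ τ → ind (X τ) * (ind (∣ τ ∣ ≡ᵇ suc D) * ind (σ ⊆ᵇ τ)))
ι-deg {n} X D σ = trans (ι-sum n _) (Σ-cong (λ τ → trans (ι-if (X τ ∧ (∣ τ ∣ ≡ᵇ suc D) ∧ (σ ⊆ᵇ τ)) 1)
  (trans (*-identityʳ _) (trans (ind-∧ (X τ) _) (cong (ind (X τ) *_) (ind-∧ (∣ τ ∣ ≡ᵇ suc D) _))))))

module Weights (X : Family n) (d : ℕ) (X-complex : IsComplex X) (X-dim : IsDimension X d) where

  X-closed : ∀ σ τ → T (σ ⊆ᵇ τ) → T (X τ) → T (X σ)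
  X-closed σ τ = proj₂ X-complex τ σ

  dg : Subset n → ℚ
  dg σ = ι (deg X d σ)

  -- A top face containing `σ` would make `σ` a face, by closure under subsets.
  dg-zero : ∀ σ → ¬ T (X σ) → dg σ ≡ 0ℚ
  dg-zero σ ¬Xσ = trans (ι-deg X d σ) (Σ-zero step)
    where
    step : ∀ τ → ind (X τ) * (ind (∣ τ ∣ ≡ᵇ suc d) * ind (σ ⊆ᵇ τ)) ≡ 0ℚ
    step τ = trans
      (ind-*-cong {q = 0ℚ} (X τ) (λ Xτ → trans
        (cong (ind (∣ τ ∣ ≡ᵇ suc d) *_) (ind≡0 (λ σ⊆τ → ¬Xσ (X-closed σ τ σ⊆τ Xτ))))
        (*-zeroʳ (ind (∣ τ ∣ ≡ᵇ suc d)))))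
      (*-zeroʳ (ind (X τ)))

  ind-X-dg : ∀ σ c → ind (X σ) * (c * dg σ) ≡ c * dg σ
  ind-X-dg σ c with T? (X σ)
  ... | yes Xσ = trans (cong (_* (c * dg σ)) (T⇒ind≡1 Xσ)) (*-identityˡ (c * dg σ))
  ... | no ¬Xσ = trans (cong (_* (c * dg σ)) (ind≡0 ¬Xσ)) (trans (*-zeroˡ (c * dg σ))
                   (sym (trans (cong (c *_) (dg-zero σ ¬Xσ)) (*-zeroʳ c))))

  -- Double counting of chains `σ ⋖ τ ⊆ θ` with `θ` a top face: each `θ` above `σ` admits one `τ`
  -- for each of its `suc d ∸ ∣ σ ∣` vertices outside `σ`.
  up-dg : ∀ σ → up σ dg ≡ ι (suc d ∸ ∣ σ ∣) * dg σ
  up-dg σ = begin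
    Σˢ (λ τ → cov σ τ * dg τ)
      ≡⟨ Σ-cong (λ τ → trans (cong (cov σ τ *_) (ι-deg X d τ)) (sym (Σ-*ˡ (cov σ τ) _))) ⟩
    Σˢ (λ τ → Σˢ (λ θ → cov σ τ * (ind (X θ) * (ind (∣ θ ∣ ≡ᵇ suc d) * ind (τ ⊆ᵇ θ)))))
      ≡⟨ Σ-swap _ ⟩
    Σˢ (λ θ → Σˢ (λ τ → cov σ τ * (ind (X θ) * (ind (∣ θ ∣ ≡ᵇ suc d) * ind (τ ⊆ᵇ θ)))))
      ≡⟨ Σ-cong (λ θ → Σ-cong (λ τ → solve 4 (λ a b c e → a :* (b :* (c :* e)) := b :* (c :* (a :* e))) refl
           (cov σ τ) (ind (X θ)) (ind (∣ θ ∣ ≡ᵇ suc d)) (ind (τ ⊆ᵇ θ)))) ⟩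
    Σˢ (λ θ → Σˢ (λ τ → ind (X θ) * (ind (∣ θ ∣ ≡ᵇ suc d) * (cov σ τ * ind (τ ⊆ᵇ θ)))))
      ≡⟨ Σ-cong (λ θ → trans (Σ-*ˡ (ind (X θ)) _) (cong (ind (X θ) *_) (trans (Σ-*ˡ (ind (∣ θ ∣ ≡ᵇ suc d)) _) (step θ)))) ⟩
    Σˢ (λ θ → ind (X θ) * (ind (∣ θ ∣ ≡ᵇ suc d) * (ι (suc d ∸ ∣ σ ∣) * ind (σ ⊆ᵇ θ))))
      ≡⟨ Σ-cong (λ θ → solve 4 (λ a b c e → a :* (b :* (c :* e)) := c :* (a :* (b :* e))) refl
           (ind (X θ)) (ind (∣ θ ∣ ≡ᵇ suc d)) (ι (suc d ∸ ∣ σ ∣)) (ind (σ ⊆ᵇ θ))) ⟩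
    Σˢ (λ θ → ι (suc d ∸ ∣ σ ∣) * (ind (X θ) * (ind (∣ θ ∣ ≡ᵇ suc d) * ind (σ ⊆ᵇ θ))))
      ≡⟨ Σ-*ˡ (ι (suc d ∸ ∣ σ ∣)) _ ⟩
    ι (suc d ∸ ∣ σ ∣) * Σˢ (λ θ → ind (X θ) * (ind (∣ θ ∣ ≡ᵇ suc d) * ind (σ ⊆ᵇ θ)))
      ≡⟨ cong (ι (suc d ∸ ∣ σ ∣) *_) (ι-deg X d σ) ⟨
    ι (suc d ∸ ∣ σ ∣) * dg σ ∎
    where
    open ≡-Reasoning
    step : ∀ θ → ind (∣ θ ∣ ≡ᵇ suc d) * Σˢ (λ τ → cov σ τ * ind (τ ⊆ᵇ θ))
               ≡ ind (∣ θ ∣ ≡ᵇ suc d) * (ι (suc d ∸ ∣ σ ∣) * ind (σ ⊆ᵇ θ))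
    step θ = ind-*-cong (∣ θ ∣ ≡ᵇ suc d) (λ e → trans (Σ-cov-above σ θ)
      (cong (λ m → ι (m ∸ ∣ σ ∣) * ind (σ ⊆ᵇ θ)) (ℕ.≡ᵇ⇒≡ ∣ θ ∣ (suc d) e)))

  -- v k is the reciprocal of the sum of the degrees of the faces with k vertices, for k ≤ suc d.
  v : ℕ → ℚ
  v zero    = frac 1 (deg X d ∅)
  v (suc k) = ι (suc k) * v k * frac 1 (suc d ∸ k)

  v-nonneg : ∀ k → 0ℚ ≤ v k
  v-nonneg zero    = frac-nonneg 1 (deg X d ∅)
  v-nonneg (suc k) = *-nonneg (*-nonneg (ι-nonneg (suc k)) (v-nonneg k)) (frac-nonneg 1 (suc d ∸ k))

  -- This ratio cancels the factor in `up-dg` and leaves `ι (suc k)` in `up-μ`. The bound on `k`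
  -- keeps the denominator of the recursive step away from zero.
  v-suc : ∀ k → k ℕ.≤ d → v (suc k) * ι (suc d ∸ k) ≡ ι (suc k) * v k
  v-suc k k≤d = begin
    ι (suc k) * v k * frac 1 (suc d ∸ k) * ι (suc d ∸ k)    ≡⟨ *-assoc (ι (suc k) * v k) _ _ ⟩
    ι (suc k) * v k * (frac 1 (suc d ∸ k) * ι (suc d ∸ k))  ≡⟨ cong (ι (suc k) * v k *_) (frac-* (ℕ.m<n⇒0<n∸m (ℕ.s≤s k≤d))) ⟩
    ι (suc k) * v k * ι 1                                   ≡⟨ *-identityʳ (ι (suc k) * v k) ⟩
    ι (suc k) * v k                                         ∎
    where open ≡-Reasoning

  μ : Subset n → ℚ
  μ σ = v ∣ σ ∣ * dg σ

  μ-nonneg : ∀ σ → 0ℚ ≤ μ σ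
  μ-nonneg σ = *-nonneg (v-nonneg ∣ σ ∣) (ι-nonneg (deg X d σ))

  μ-zero : ∀ σ → ¬ T (X σ) → μ σ ≡ 0ℚ
  μ-zero σ ¬Xσ = trans (cong (v ∣ σ ∣ *_) (dg-zero σ ¬Xσ)) (*-zeroʳ (v ∣ σ ∣))

  up-weighted : ∀ σ (f : Subset n → ℚ) → up σ (λ τ → f τ * μ τ) ≡ v (suc ∣ σ ∣) * up σ (λ τ → f τ * dg τ)
  up-weighted σ f = trans
    (up-cong σ (λ τ c → trans (cong (λ k → f τ * (v k * dg τ)) (⋖⇒∣∣ σ τ c)) (*-swap (f τ) (v (suc ∣ σ ∣)) (dg τ))))
    (up-* σ (v (suc ∣ σ ∣)) _)

  up-μ : ∀ σ → ∣ σ ∣ ℕ.≤ d → up σ μ ≡ ι (suc ∣ σ ∣) * μ σ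
  up-μ σ σ≤d = begin
    up σ μ                                            ≡⟨ up-cong σ (λ τ _ → sym (*-identityˡ (μ τ))) ⟩
    up σ (λ τ → 1ℚ * μ τ)                             ≡⟨ up-weighted σ (λ _ → 1ℚ) ⟩
    v (suc ∣ σ ∣) * up σ (λ τ → 1ℚ * dg τ)            ≡⟨ cong (v (suc ∣ σ ∣) *_) (up-cong σ (λ τ _ → *-identityˡ (dg τ))) ⟩
    v (suc ∣ σ ∣) * up σ dg                           ≡⟨ cong (v (suc ∣ σ ∣) *_) (up-dg σ) ⟩
    v (suc ∣ σ ∣) * (ι (suc d ∸ ∣ σ ∣) * dg σ)        ≡⟨ *-assoc (v (suc ∣ σ ∣)) _ (dg σ) ⟨
    v (suc ∣ σ ∣) * ι (suc d ∸ ∣ σ ∣) * dg σ          ≡⟨ cong (_* dg σ) (v-suc ∣ σ ∣ σ≤d) ⟩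
    ι (suc ∣ σ ∣) * v ∣ σ ∣ * dg σ                    ≡⟨ *-assoc (ι (suc ∣ σ ∣)) (v ∣ σ ∣) (dg σ) ⟩
    ι (suc ∣ σ ∣) * μ σ                               ∎
    where open ≡-Reasoning

  -- The `d`-face provided by `IsDimension` contains the empty face, so the normalising constant
  -- `v 0` is a true reciprocal.
  deg∅≥1 : 1 ℕ.≤ deg X d ∅
  deg∅≥1 = ℕ.n≢0⇒n>0 (λ e → ≤⇒≯ (≤-trans 1≤dg∅ (≤-reflexive (cong ι e))) (positive⁻¹ 1ℚ))
    where
    θ = proj₁ (proj₂ X-dim)
    Xθ = proj₁ (proj₂ (proj₂ X-dim))
    ∣θ∣ = proj₂ (proj₂ (proj₂ X-dim))
    ∅⊆ᵇ : ∀ {m} (τ : Subset m) → T (∅ ⊆ᵇ τ)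
    ∅⊆ᵇ []      = tt
    ∅⊆ᵇ (b ∷ τ) = ∅⊆ᵇ τ
    1≤dg∅ : 1ℚ ≤ dg ∅
    1≤dg∅ = begin
      1ℚ
        ≡⟨ cong₂ (λ a b → a * b) (T⇒ind≡1 Xθ) (cong₂ _*_ (T⇒ind≡1 (ℕ.≡⇒≡ᵇ ∣ θ ∣ (suc d) ∣θ∣)) (T⇒ind≡1 (∅⊆ᵇ θ))) ⟨
      ind (X θ) * (ind (∣ θ ∣ ≡ᵇ suc d) * ind (∅ ⊆ᵇ θ))
        ≤⟨ term≤Σ (λ τ → *-nonneg (ind-nonneg (X τ)) (*-nonneg (ind-nonneg (∣ τ ∣ ≡ᵇ suc d)) (ind-nonneg (∅ ⊆ᵇ τ)))) θ ⟩
      Σˢ (λ τ → ind (X τ) * (ind (∣ τ ∣ ≡ᵇ suc d) * ind (∅ ⊆ᵇ τ)))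
        ≡⟨ ι-deg X d ∅ ⟨
      dg ∅ ∎
      where open ≤-Reasoning

  μ∅≡1 : μ ∅ ≡ 1ℚ
  μ∅≡1 = trans (cong (λ k → v k * dg ∅) (∣∅∣≡0 n)) (frac-* deg∅≥1)

  -- Summing `up-μ` over a level shows that the next level has the same total weight; the start is
  -- `μ∅≡1`.
  lev-μ : ∀ k → k ℕ.≤ suc d → lev k μ ≡ 1ℚ
  lev-μ zero    _ = trans (lev-zero μ) μ∅≡1
  lev-μ (suc k) (ℕ.s≤s k≤d) = *-cancelˡ (ι-suc-pos k) (begin
    ι (suc k) * lev (suc k) μ          ≡⟨ lev-up k μ ⟨
    lev k (λ σ → up σ μ)               ≡⟨ lev-cong k (λ σ e → trans (up-μ σ (subst (ℕ._≤ d) (sym e) k≤d)) (cong (λ m → ι (suc m) * μ σ) e)) ⟩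
    lev k (λ σ → ι (suc k) * μ σ)      ≡⟨ lev-* k (ι (suc k)) μ ⟩
    ι (suc k) * lev k μ                ≡⟨ cong (ι (suc k) *_) (lev-μ k (ℕ.m≤n⇒m≤1+n k≤d)) ⟩
    ι (suc k) * 1ℚ                     ∎)
    where
    open ≡-Reasoning
    *-cancelˡ : ∀ {p q r} → 0ℚ < r → r * p ≡ r * q → p ≡ q
    *-cancelˡ 0<r e = ≤-antisym (*-cancelˡ-≤ 0<r (≤-reflexive e)) (*-cancelˡ-≤ 0<r (≤-reflexive (sym e)))

  lev-weighted : ∀ i P → v (suc i) * ι (degSum X d i P) ≡ lev (suc i) (λ σ → ind (P σ) * μ σ)
  lev-weighted i P = begin
    v (suc i) * ι (degSum X d i P)
      ≡⟨ cong (v (suc i) *_) (ι-degSum X d i P) ⟩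
    v (suc i) * Σˢ (λ σ → ind (X σ) * (ind (∣ σ ∣ ≡ᵇ suc i) * (ind (P σ) * dg σ)))
      ≡⟨ cong (v (suc i) *_) (Σ-cong (λ σ → trans
           (*-swap (ind (X σ)) (ind (∣ σ ∣ ≡ᵇ suc i)) (ind (P σ) * dg σ))
           (cong (ind (∣ σ ∣ ≡ᵇ suc i) *_) (ind-X-dg σ (ind (P σ)))))) ⟩
    v (suc i) * lev (suc i) (λ σ → ind (P σ) * dg σ)
      ≡⟨ lev-* (suc i) (v (suc i)) _ ⟨
    lev (suc i) (λ σ → v (suc i) * (ind (P σ) * dg σ))
      ≡⟨ lev-cong (suc i) (λ σ e → trans (*-swap (v (suc i)) (ind (P σ)) (dg σ)) (cong (λ m → ind (P σ) * (v m * dg σ)) (sym e))) ⟩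
    lev (suc i) (λ σ → ind (P σ) * μ σ) ∎
    where open ≡-Reasoning

  -- Multiplying by the total weight 1 of the level introduces exactly the denominator of the norm,
  -- which then cancels.
  norm≡lev : ∀ i → i ℕ.≤ d → ∀ P → norm X d i P ≡ lev (suc i) (λ σ → ind (P σ) * μ σ)
  norm≡lev i i≤d P = begin
    r                                             ≡⟨ *-identityʳ r ⟨
    r * 1ℚ                                        ≡⟨ cong (r *_) (lev-μ (suc i) (ℕ.s≤s i≤d)) ⟨
    r * lev (suc i) μ                             ≡⟨ cong (r *_) (lev-cong (suc i) (λ σ _ → sym (*-identityˡ (μ σ)))) ⟩
    r * lev (suc i) (λ σ → 1ℚ * μ σ)              ≡⟨ cong (r *_) (lev-weighted i (λ _ → true)) ⟨
    r * (v (suc i) * ι (degSum X d i (λ _ → true))) ≡⟨ *-swap r (v (suc i)) _ ⟩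
    v (suc i) * (r * ι (degSum X d i (λ _ → true))) ≡⟨ cong (v (suc i) *_) (norm-* X d i P) ⟩
    v (suc i) * ι (degSum X d i P)                ≡⟨ lev-weighted i P ⟩
    lev (suc i) (λ σ → ind (P σ) * μ σ)           ∎
    where
    open ≡-Reasoning
    r = norm X d i P

-- Skeleton expansion in a link

─-∪-cancel : (σ τ : Subset n) → T (σ ⊆ᵇ τ) → (τ ─ σ) ∪ σ ≡ τ
─-∪-cancel []          []          h = refl
─-∪-cancel (false ∷ σ) (false ∷ τ) h = cong (false ∷_) (─-∪-cancel σ τ h)
─-∪-cancel (false ∷ σ) (true ∷ τ)  h = cong (true ∷_) (─-∪-cancel σ τ h)
─-∪-cancel (true ∷ σ)  (true ∷ τ)  h = cong (true ∷_) (─-∪-cancel σ τ h)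

─-disjoint : (τ σ : Subset n) → T (disjointᵇ (τ ─ σ) σ)
─-disjoint []          []          = tt
─-disjoint (false ∷ τ) (false ∷ σ) = ─-disjoint τ σ
─-disjoint (true ∷ τ)  (false ∷ σ) = ─-disjoint τ σ
─-disjoint (b ∷ τ)     (true ∷ σ)  = ─-disjoint τ σ

∪-⊆ᵇ : (ρ σ τ : Subset n) → T (ρ ⊆ᵇ τ) → T (σ ⊆ᵇ τ) → T ((ρ ∪ σ) ⊆ᵇ τ)
∪-⊆ᵇ ρ σ τ h k = ⊆⇒⊆ᵇ (ρ ∪ σ) τ (λ x∈ → [ ⊆ᵇ⇒⊆ ρ τ h , ⊆ᵇ⇒⊆ σ τ k ]′ (x∈p∪q⁻ ρ σ x∈))

⊆ᵇ-∪ˡ : (ρ σ : Subset n) → T (ρ ⊆ᵇ (ρ ∪ σ))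
⊆ᵇ-∪ˡ ρ σ = ⊆⇒⊆ᵇ ρ (ρ ∪ σ) (p⊆p∪q σ)

⊆ᵇ-∪ʳ : (ρ σ : Subset n) → T (σ ⊆ᵇ (ρ ∪ σ))
⊆ᵇ-∪ʳ ρ σ = ⊆⇒⊆ᵇ σ (ρ ∪ σ) (q⊆p∪q ρ σ)

disjoint-⊆-∪ : (ρ σ τ : Subset n) → T (disjointᵇ ρ σ) → T (ρ ⊆ᵇ (τ ∪ σ)) → T (ρ ⊆ᵇ τ)
disjoint-⊆-∪ ρ σ τ dis h = ⊆⇒⊆ᵇ ρ τ (λ x∈ρ →
  [ (λ x∈τ → x∈τ) , (λ x∈σ → ⊥-elim (disjoint⇒∉ ρ σ dis x∈ρ x∈σ)) ]′ (x∈p∪q⁻ τ σ (⊆ᵇ⇒⊆ ρ (τ ∪ σ) h x∈ρ)))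

ind-size-∪ : (ρ σ : Subset n) (m : ℕ) → T (disjointᵇ ρ σ) → ind (∣ ρ ∣ ≡ᵇ m) ≡ ind (∣ ρ ∪ σ ∣ ≡ᵇ m ℕ.+ ∣ σ ∣)
ind-size-∪ ρ σ m dis = ind-cong
  (λ e → ℕ.≡⇒≡ᵇ ∣ ρ ∪ σ ∣ (m ℕ.+ ∣ σ ∣) (trans size (cong (ℕ._+ ∣ σ ∣) (ℕ.≡ᵇ⇒≡ ∣ ρ ∣ m e))))
  (λ e → ℕ.≡⇒≡ᵇ ∣ ρ ∣ m (ℕ.+-cancelʳ-≡ ∣ σ ∣ ∣ ρ ∣ m (trans (sym size) (ℕ.≡ᵇ⇒≡ ∣ ρ ∪ σ ∣ (m ℕ.+ ∣ σ ∣) e))))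
  where size = ∣∪∣-disjoint ρ σ dis

module Local (X : Family n) (d : ℕ) (X-complex : IsComplex X) (X-dim : IsDimension X d) where

  open Weights X d X-complex X-dim

  -- Adding `σ` turns the top faces of the link that contain `ρ` into the top faces of `X` that
  -- contain `ρ ∪ σ`.
  link-deg : ∀ σ ρ → ∣ σ ∣ ℕ.≤ d → T (disjointᵇ ρ σ) → ι (deg (link X σ) (d ∸ ∣ σ ∣) ρ) ≡ dg (ρ ∪ σ)
  link-deg σ ρ σ≤d dis = begin
    ι (deg (link X σ) (d ∸ ∣ σ ∣) ρ)
      ≡⟨ ι-deg (link X σ) (d ∸ ∣ σ ∣) ρ ⟩
    Σˢ (λ τ → ind (disjointᵇ τ σ ∧ X (τ ∪ σ)) * (ind (∣ τ ∣ ≡ᵇ suc (d ∸ ∣ σ ∣)) * ind (ρ ⊆ᵇ τ)))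
      ≡⟨ Σ-cong step ⟩
    Σˢ (λ τ → ind (disjointᵇ τ σ) * h (τ ∪ σ))
      ≡⟨ Σ-disjoint≡Σ-superset σ (λ _ → h) ⟩
    Σˢ (λ κ → ind (σ ⊆ᵇ κ) * h κ)
      ≡⟨ Σ-cong drop ⟩
    Σˢ h
      ≡⟨ ι-deg X d (ρ ∪ σ) ⟨
    dg (ρ ∪ σ) ∎
    where
    open ≡-Reasoning
    h : Subset n → ℚ
    h κ = ind (X κ) * (ind (∣ κ ∣ ≡ᵇ suc d) * ind ((ρ ∪ σ) ⊆ᵇ κ))
    size : ∀ τ → T (disjointᵇ τ σ) → ind (∣ τ ∣ ≡ᵇ suc (d ∸ ∣ σ ∣)) ≡ ind (∣ τ ∪ σ ∣ ≡ᵇ suc d)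
    size τ dis′ = trans (ind-size-∪ τ σ (suc (d ∸ ∣ σ ∣)) dis′)
      (cong (λ m → ind (∣ τ ∪ σ ∣ ≡ᵇ suc m)) (ℕ.m∸n+n≡m σ≤d))
    incl : ∀ τ → ind (ρ ⊆ᵇ τ) ≡ ind ((ρ ∪ σ) ⊆ᵇ (τ ∪ σ))
    incl τ = ind-cong
      (λ ρ⊆τ → ∪-⊆ᵇ ρ σ (τ ∪ σ) (⊆ᵇ-trans ρ τ (τ ∪ σ) ρ⊆τ (⊆ᵇ-∪ˡ τ σ)) (⊆ᵇ-∪ʳ τ σ))
      (λ ⊆′ → disjoint-⊆-∪ ρ σ τ dis (⊆ᵇ-trans ρ (ρ ∪ σ) (τ ∪ σ) (⊆ᵇ-∪ˡ ρ σ) ⊆′))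
    step : ∀ τ → ind (disjointᵇ τ σ ∧ X (τ ∪ σ)) * (ind (∣ τ ∣ ≡ᵇ suc (d ∸ ∣ σ ∣)) * ind (ρ ⊆ᵇ τ))
               ≡ ind (disjointᵇ τ σ) * h (τ ∪ σ)
    step τ = trans (cong (_* y) (ind-∧ (disjointᵇ τ σ) (X (τ ∪ σ)))) (trans
      (*-assoc (ind (disjointᵇ τ σ)) (ind (X (τ ∪ σ))) y)
      (ind-*-cong (disjointᵇ τ σ) (λ dis′ → cong (ind (X (τ ∪ σ)) *_) (cong₂ _*_ (size τ dis′) (incl τ)))))
      where y = ind (∣ τ ∣ ≡ᵇ suc (d ∸ ∣ σ ∣)) * ind (ρ ⊆ᵇ τ)
    -- The indicator is absorbed because `h` already forces `ρ ∪ σ` to lie in `κ`.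
    drop : ∀ κ → ind (σ ⊆ᵇ κ) * h κ ≡ h κ
    drop κ = begin
      ind (σ ⊆ᵇ κ) * (ind (X κ) * (ind (∣ κ ∣ ≡ᵇ suc d) * i))
        ≡⟨ solve 4 (λ a b c e → a :* (b :* (c :* e)) := b :* (c :* (e :* a))) refl (ind (σ ⊆ᵇ κ)) (ind (X κ)) (ind (∣ κ ∣ ≡ᵇ suc d)) i ⟩
      ind (X κ) * (ind (∣ κ ∣ ≡ᵇ suc d) * (i * ind (σ ⊆ᵇ κ)))
        ≡⟨ cong (λ y → ind (X κ) * (ind (∣ κ ∣ ≡ᵇ suc d) * y)) (trans
             (ind-*-cong ((ρ ∪ σ) ⊆ᵇ κ) (λ ⊆′ → T⇒ind≡1 (⊆ᵇ-trans σ (ρ ∪ σ) κ (⊆ᵇ-∪ʳ ρ σ) ⊆′))) (*-identityʳ i)) ⟩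
      h κ ∎
      where i = ind ((ρ ∪ σ) ⊆ᵇ κ)

  link-degSum : ∀ σ → ∣ σ ∣ ℕ.≤ d → ∀ i Q → ι (degSum (link X σ) (d ∸ ∣ σ ∣) i Q) ≡
    Σˢ (λ κ → ind (σ ⊆ᵇ κ) * (ind (∣ κ ∣ ≡ᵇ suc i ℕ.+ ∣ σ ∣) * (ind (Q (κ ─ σ)) * dg κ)))
  link-degSum σ σ≤d i Q = begin
    ι (degSum (link X σ) (d ∸ ∣ σ ∣) i Q)
      ≡⟨ ι-degSum (link X σ) (d ∸ ∣ σ ∣) i Q ⟩
    Σˢ (λ ρ → ind (disjointᵇ ρ σ ∧ X (ρ ∪ σ)) * (ind (∣ ρ ∣ ≡ᵇ suc i) * (ind (Q ρ) * ι (deg (link X σ) (d ∸ ∣ σ ∣) ρ))))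
      ≡⟨ Σ-cong step ⟩
    Σˢ (λ ρ → ind (disjointᵇ ρ σ) * h ρ (ρ ∪ σ))
      ≡⟨ Σ-disjoint≡Σ-superset σ h ⟩
    Σˢ (λ κ → ind (σ ⊆ᵇ κ) * h (κ ─ σ) κ)
      ≡⟨ Σ-cong (λ κ → cong (ind (σ ⊆ᵇ κ) *_) (drop (κ ─ σ) κ)) ⟩
    Σˢ (λ κ → ind (σ ⊆ᵇ κ) * (ind (∣ κ ∣ ≡ᵇ suc i ℕ.+ ∣ σ ∣) * (ind (Q (κ ─ σ)) * dg κ))) ∎
    where
    open ≡-Reasoning
    h : Subset n → Subset n → ℚ
    h ρ κ = ind (X κ) * (ind (∣ κ ∣ ≡ᵇ suc i ℕ.+ ∣ σ ∣) * (ind (Q ρ) * dg κ))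
    step : ∀ ρ → ind (disjointᵇ ρ σ ∧ X (ρ ∪ σ)) * (ind (∣ ρ ∣ ≡ᵇ suc i) * (ind (Q ρ) * ι (deg (link X σ) (d ∸ ∣ σ ∣) ρ)))
               ≡ ind (disjointᵇ ρ σ) * h ρ (ρ ∪ σ)
    step ρ = trans (cong (_* y) (ind-∧ (disjointᵇ ρ σ) (X (ρ ∪ σ)))) (trans (*-assoc (ind (disjointᵇ ρ σ)) (ind (X (ρ ∪ σ))) y)
      (ind-*-cong (disjointᵇ ρ σ) (λ dis → cong (ind (X (ρ ∪ σ)) *_)
        (cong₂ _*_ (ind-size-∪ ρ σ (suc i) dis) (cong (ind (Q ρ) *_) (link-deg σ ρ σ≤d dis))))))
      where y = ind (∣ ρ ∣ ≡ᵇ suc i) * (ind (Q ρ) * ι (deg (link X σ) (d ∸ ∣ σ ∣) ρ))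
    drop : ∀ ρ κ → h ρ κ ≡ ind (∣ κ ∣ ≡ᵇ suc i ℕ.+ ∣ σ ∣) * (ind (Q ρ) * dg κ)
    drop ρ κ = trans (*-swap (ind (X κ)) s (ind (Q ρ) * dg κ)) (cong (s *_) (ind-X-dg κ (ind (Q ρ))))
      where s = ind (∣ κ ∣ ≡ᵇ suc i ℕ.+ ∣ σ ∣)

  private
    drop-1 : ∀ (f : Subset n → ℚ) τ → ind true * f τ ≡ f τ
    drop-1 f τ = *-identityˡ (f τ)

  -- The common factor `v (suc ∣ σ ∣)` turns degrees in the link into weights in `X`. The product
  -- form also covers a link of total weight zero.
  link-norm-vertices : ∀ σ → ∣ σ ∣ ℕ.≤ d → ∀ Q →
    norm (link X σ) (d ∸ ∣ σ ∣) 0 Q * up σ μ ≡ up σ (λ τ → ind (Q (τ ─ σ)) * μ τ)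
  link-norm-vertices σ σ≤d Q = begin
    r * up σ μ                                          ≡⟨ cong (r *_) (up-cong σ (λ τ _ → sym (drop-1 μ τ))) ⟩
    r * up σ (λ τ → ind true * μ τ)                     ≡⟨ cong (r *_) (weigh (λ _ → true)) ⟩
    r * (v (suc ∣ σ ∣) * ι (degSum (link X σ) (d ∸ ∣ σ ∣) 0 (λ _ → true)))
                                                        ≡⟨ *-swap r (v (suc ∣ σ ∣)) _ ⟩
    v (suc ∣ σ ∣) * (r * ι (degSum (link X σ) (d ∸ ∣ σ ∣) 0 (λ _ → true)))
                                                        ≡⟨ cong (v (suc ∣ σ ∣) *_) (norm-* (link X σ) (d ∸ ∣ σ ∣) 0 Q) ⟩
    v (suc ∣ σ ∣) * ι (degSum (link X σ) (d ∸ ∣ σ ∣) 0 Q) ≡⟨ weigh Q ⟨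
    up σ (λ τ → ind (Q (τ ─ σ)) * μ τ)                  ∎
    where
    open ≡-Reasoning
    r = norm (link X σ) (d ∸ ∣ σ ∣) 0 Q
    weigh : ∀ R → up σ (λ τ → ind (R (τ ─ σ)) * μ τ) ≡ v (suc ∣ σ ∣) * ι (degSum (link X σ) (d ∸ ∣ σ ∣) 0 R)
    weigh R = trans (up-weighted σ (λ τ → ind (R (τ ─ σ))))
      (cong (v (suc ∣ σ ∣) *_) (trans (up-as-Σ σ _) (sym (link-degSum σ σ≤d 0 R))))

  -- As for vertices; the factor 2 in `w`, from reaching each edge through both endpoints, occurs in
  -- numerator and denominator alike.
  link-norm-edges : ∀ σ → ∣ σ ∣ ℕ.≤ d → ∀ Q →
    norm (link X σ) (d ∸ ∣ σ ∣) 1 Q * up σ (λ τ → up τ μ) ≡ up σ (λ τ → up τ (λ κ → ind (Q (κ ─ σ)) * μ κ))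
  link-norm-edges σ σ≤d Q = begin
    r * up σ (λ τ → up τ μ)                       ≡⟨ cong (r *_) (up-cong σ (λ τ _ → up-cong τ (λ κ _ → sym (drop-1 μ κ)))) ⟩
    r * up σ (λ τ → up τ (λ κ → ind true * μ κ))  ≡⟨ cong (r *_) (weigh (λ _ → true)) ⟩
    r * (w * ι (degSum (link X σ) (d ∸ ∣ σ ∣) 1 (λ _ → true)))
                                                  ≡⟨ *-swap r w _ ⟩
    w * (r * ι (degSum (link X σ) (d ∸ ∣ σ ∣) 1 (λ _ → true)))
                                                  ≡⟨ cong (w *_) (norm-* (link X σ) (d ∸ ∣ σ ∣) 1 Q) ⟩
    w * ι (degSum (link X σ) (d ∸ ∣ σ ∣) 1 Q)     ≡⟨ weigh Q ⟨
    up σ (λ τ → up τ (λ κ → ind (Q (κ ─ σ)) * μ κ)) ∎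
    where
    open ≡-Reasoning
    r = norm (link X σ) (d ∸ ∣ σ ∣) 1 Q
    w = v (suc (suc ∣ σ ∣)) * ι 2
    weigh : ∀ R → up σ (λ τ → up τ (λ κ → ind (R (κ ─ σ)) * μ κ)) ≡ w * ι (degSum (link X σ) (d ∸ ∣ σ ∣) 1 R)
    weigh R = begin
      up σ (λ τ → up τ (λ κ → ind (R (κ ─ σ)) * μ κ))
        ≡⟨ up-cong σ (λ τ c → trans (up-weighted τ (λ κ → ind (R (κ ─ σ))))
             (cong (λ k → v (suc k) * up τ (λ κ → ind (R (κ ─ σ)) * dg κ)) (⋖⇒∣∣ σ τ c))) ⟩
      up σ (λ τ → v (suc (suc ∣ σ ∣)) * up τ (λ κ → ind (R (κ ─ σ)) * dg κ))
        ≡⟨ up-* σ (v (suc (suc ∣ σ ∣))) _ ⟩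
      v (suc (suc ∣ σ ∣)) * up σ (λ τ → up τ (λ κ → ind (R (κ ─ σ)) * dg κ))
        ≡⟨ cong (v (suc (suc ∣ σ ∣)) *_) (trans (up-up σ _) (cong (ι 2 *_) (sym (link-degSum σ σ≤d 1 R)))) ⟩
      v (suc (suc ∣ σ ∣)) * (ι 2 * ι (degSum (link X σ) (d ∸ ∣ σ ∣) 1 R))
        ≡⟨ *-assoc (v (suc (suc ∣ σ ∣))) (ι 2) _ ⟨
      w * ι (degSum (link X σ) (d ∸ ∣ σ ∣) 1 R) ∎

  module _ (α : ℚ) (0<α : 0ℚ < α) (X-expands : IsSkeletonExpander X d α) where

    -- View the cofaces in `Q` as vertices of the link of `σ`. An edge with an endpoint in `Q`
    -- either has both ends in the vertex set `S` or is mixed and satisfies `z`. Skeleton expansion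
    -- bounds the first kind, so the second must carry the rest. Everything is multiplied by `A` to
    -- avoid division.
    local-expansion : ∀ σ → T (X σ) → ∣ σ ∣ ℕ.< d → (Q z : Subset n → Bool) →
      (∀ κ τ τ′ → T (X κ) → ∣ κ ∣ ≡ suc (suc ∣ σ ∣) → T (τ ⋖ᵇ κ) → T (τ′ ⋖ᵇ κ) → T (Q τ) → ¬ T (Q τ′) → T (z κ)) →
      let a = up σ (λ τ → ind (Q τ) * μ τ); A = ι (suc ∣ σ ∣) * μ σ in
      ι (suc (suc ∣ σ ∣)) * a * (A - a - α * A) ≤ up σ (λ τ → up τ (λ κ → ind (z κ) * μ κ)) * A
    local-expansion σ Xσ σ<d Q z mixed =
      arithmetic K a a′ A e x nS nE α (ι-nonneg (suc (suc ∣ σ ∣))) a′-nonneg A-nonneg (<⇒≤ 0<α) nS-A nE-KA a′≤a Ka≤e+x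
        (X-expands σ Xσ S S⊆link)
      where
      σ≤d = ℕ.<⇒≤ σ<d
      S : Subset n
      -- The expansion hypothesis speaks only of vertices of the link, so link membership is built
      -- in; this is why `a′` is compared with `a` only by an inequality.
      S = tabulate (λ w → link X σ ⁅ w ⁆ ∧ Q (⁅ w ⁆ ∪ σ))
      K = ι (suc (suc ∣ σ ∣))
      a = up σ (λ τ → ind (Q τ) * μ τ)
      A = ι (suc ∣ σ ∣) * μ σ
      a′ = up σ (λ τ → ind (vertCochain S (τ ─ σ)) * μ τ)
      e = up σ (λ τ → up τ (λ κ → ind (E S (κ ─ σ)) * μ κ))
      x = up σ (λ τ → up τ (λ κ → ind (z κ) * μ κ))
      nS = norm (link X σ) (d ∸ ∣ σ ∣) 0 (vertCochain S)
      nE = norm (link X σ) (d ∸ ∣ σ ∣) 1 (E S)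

      ∈S⁻ : ∀ {w} → w ∈ S → T (link X σ ⁅ w ⁆) × T (Q (⁅ w ⁆ ∪ σ))
      ∈S⁻ {w} w∈S = T-∧⁻ {link X σ ⁅ w ⁆} (Equivalence.from T-≡ (trans (sym (lookup∘tabulate _ w)) ([]=⇒lookup w∈S)))

      ∈S⁺ : ∀ {w} → T (link X σ ⁅ w ⁆) → T (Q (⁅ w ⁆ ∪ σ)) → w ∈ S
      ∈S⁺ {w} l q = lookup⇒[]= w S (trans (lookup∘tabulate _ w) (Equivalence.to T-≡ (T-∧⁺ l q)))

      vertCochain⁻ : ∀ ρ → T (vertCochain S ρ) → T (link X σ ρ) × T (Q (ρ ∪ σ))
      vertCochain⁻ ρ h with ∣∣≡1⇒singleton ρ (ℕ.≡ᵇ⇒≡ ∣ ρ ∣ 1 (proj₁ (T-∧⁻ {∣ ρ ∣ ≡ᵇ 1} h)))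
      ... | w , refl = ∈S⁻ (⊆ᵇ⇒⊆ ⁅ w ⁆ S (proj₂ (T-∧⁻ {∣ ⁅ w ⁆ ∣ ≡ᵇ 1} h)) (x∈⁅x⁆ w))

      S⊆link : ∀ ρ → T (vertCochain S ρ) → T (link X σ ρ)
      S⊆link ρ = proj₁ ∘ vertCochain⁻ ρ

      A-nonneg : 0ℚ ≤ A
      A-nonneg = *-nonneg (ι-nonneg (suc ∣ σ ∣)) (μ-nonneg σ)

      a′-nonneg : 0ℚ ≤ a′
      a′-nonneg = up-nonneg σ (λ τ → *-nonneg (ind-nonneg (vertCochain S (τ ─ σ))) (μ-nonneg τ))

      nS-A : nS * A ≡ a′
      nS-A = trans (cong (nS *_) (sym (up-μ σ σ≤d))) (link-norm-vertices σ σ≤d (vertCochain S))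

      up-μ-cover : ∀ τ → T (σ ⋖ᵇ τ) → up τ μ ≡ K * μ τ
      up-μ-cover τ c = trans (up-μ τ (subst (ℕ._≤ d) (sym (⋖⇒∣∣ σ τ c)) σ<d)) (cong (λ k → ι (suc k) * μ τ) (⋖⇒∣∣ σ τ c))

      up-up-μ : up σ (λ τ → up τ μ) ≡ K * A
      up-up-μ = trans (up-cong σ up-μ-cover)
        (trans (up-* σ K μ) (cong (K *_) (up-μ σ σ≤d)))

      nE-KA : nE * (K * A) ≡ e
      nE-KA = trans (cong (nE *_) (sym up-up-μ)) (link-norm-edges σ σ≤d (E S))

      a′≤a : a′ ≤ a
      a′≤a = up-mono σ (λ τ c → *-monoʳ-≤ (μ-nonneg τ) (ind-mono (λ h →
        subst (T ∘ Q) (─-∪-cancel σ τ (⋖⇒⊆ σ τ c)) (proj₂ (vertCochain⁻ (τ ─ σ) h)))))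

      -- One of the two vertices of `κ ─ σ` is outside `S`. Adding it to `σ` gives a facet `τ′` of
      -- `κ`, a face by closure, so `τ′` can only have failed membership in `Q`.
      edge-or-mixed : ∀ τ κ → T (σ ⋖ᵇ τ) → T (τ ⋖ᵇ κ) → T (X κ) → T (Q τ) → ¬ T (E S (κ ─ σ)) → T (z κ)
      edge-or-mixed τ κ σ⋖τ τ⋖κ Xκ Qτ ¬E = mixed κ τ τ′ Xκ ∣κ∣ τ⋖κ τ′⋖κ Qτ ¬Qτ′
        where
        σ⊆κ = ⊆ᵇ-trans σ τ κ (⋖⇒⊆ σ τ σ⋖τ) (⋖⇒⊆ τ κ τ⋖κ)
        ∣κ∣ : ∣ κ ∣ ≡ suc (suc ∣ σ ∣)
        ∣κ∣ = trans (⋖⇒∣∣ τ κ τ⋖κ) (cong suc (⋖⇒∣∣ σ τ σ⋖τ))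
        ∣κ─σ∣ : ∣ κ ─ σ ∣ ≡ 2
        ∣κ─σ∣ = ℕ.+-cancelʳ-≡ ∣ σ ∣ ∣ κ ─ σ ∣ 2 (trans (sym (∣∪∣-disjoint (κ ─ σ) σ (─-disjoint κ σ)))
          (trans (cong ∣_∣ (─-∪-cancel σ κ σ⊆κ)) ∣κ∣))
        outside-S : ∃ λ w → w ∈ (κ ─ σ) × w ∉ S
        outside-S = ⊈ᵇ⇒witness (κ ─ σ) S (λ ⊆S → ¬E (T-∧⁺ (ℕ.≡⇒≡ᵇ ∣ κ ─ σ ∣ 2 ∣κ─σ∣) ⊆S))
        w = proj₁ outside-S
        w∈ = proj₁ (proj₂ outside-S)
        τ′ = ⁅ w ⁆ ∪ σ
        dis : T (disjointᵇ ⁅ w ⁆ σ)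
        dis = ∉⇒disjoint ⁅ w ⁆ σ (λ y∈ y∈σ → disjoint⇒∉ (κ ─ σ) σ (─-disjoint κ σ) w∈ (subst (_∈ σ) (x∈⁅y⁆⇒x≡y w y∈) y∈σ))
        τ′⊆κ : T (τ′ ⊆ᵇ κ)
        τ′⊆κ = ∪-⊆ᵇ ⁅ w ⁆ σ κ (⊆⇒⊆ᵇ ⁅ w ⁆ κ (λ y∈ → subst (_∈ κ) (sym (x∈⁅y⁆⇒x≡y w y∈)) (p─q⊆p κ σ w∈))) σ⊆κ
        τ′⋖κ : T (τ′ ⋖ᵇ κ)
        τ′⋖κ = ⋖-intro τ′ κ τ′⊆κ (trans ∣κ∣ (cong suc (sym (trans (∣∪∣-disjoint ⁅ w ⁆ σ dis) (cong (ℕ._+ ∣ σ ∣) (∣⁅x⁆∣≡1 w))))))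
        ¬Qτ′ : ¬ T (Q τ′)
        ¬Qτ′ q = proj₂ (proj₂ outside-S) (∈S⁺ (T-∧⁺ dis (X-closed τ′ κ τ′⊆κ Xκ)) q)

      pointwise : ∀ τ κ → T (σ ⋖ᵇ τ) → T (τ ⋖ᵇ κ) → ind (Q τ) * μ κ ≤ ind (E S (κ ─ σ)) * μ κ + ind (z κ) * μ κ
      pointwise τ κ σ⋖τ τ⋖κ with T? (X κ)
      ... | no ¬Xκ rewrite μ-zero κ ¬Xκ | *-zeroʳ (ind (Q τ)) | *-zeroʳ (ind (E S (κ ─ σ))) | *-zeroʳ (ind (z κ)) = ≤-refl
      ... | yes Xκ = subst (ind (Q τ) * μ κ ≤_) (*-distribʳ-+ (μ κ) (ind (E S (κ ─ σ))) (ind (z κ)))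
        (*-monoʳ-≤ (μ-nonneg κ) bound)
        where
        bound : ind (Q τ) ≤ ind (E S (κ ─ σ)) + ind (z κ)
        bound with T? (E S (κ ─ σ))
        ... | yes h = ≤-trans (ind-≤1 (Q τ)) (≤-by-difference (cong (_+ ind (z κ)) (T⇒ind≡1 h)) (ind-nonneg (z κ)))
        ... | no ¬h = ≤-trans (ind-mono (λ Qτ → edge-or-mixed τ κ σ⋖τ τ⋖κ Xκ Qτ ¬h))
                        (≤-reflexive (sym (trans (cong (_+ ind (z κ)) (ind≡0 ¬h)) (+-identityˡ (ind (z κ))))))

      Ka≤e+x : K * a ≤ e + x
      Ka≤e+x = begin
        K * a
          ≡⟨ up-* σ K _ ⟨
        up σ (λ τ → K * (ind (Q τ) * μ τ))
          ≡⟨ up-cong σ (λ τ c → trans (*-swap K (ind (Q τ)) (μ τ)) (trans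
               (cong (ind (Q τ) *_) (sym (up-μ-cover τ c))) (sym (up-* τ (ind (Q τ)) μ)))) ⟩
        up σ (λ τ → up τ (λ κ → ind (Q τ) * μ κ))
          ≤⟨ up-mono σ (λ τ c → up-mono τ (λ κ c′ → pointwise τ κ c c′)) ⟩
        up σ (λ τ → up τ (λ κ → ind (E S (κ ─ σ)) * μ κ + ind (z κ) * μ κ))
          ≡⟨ trans (up-cong σ (λ τ _ → up-+ τ _ _)) (up-+ σ _ _) ⟩
        e + x ∎
        where open ≤-Reasoning

      arithmetic : ∀ K a a′ A e x nS nE α → 0ℚ ≤ K → 0ℚ ≤ a′ → 0ℚ ≤ A → 0ℚ ≤ α → nS * A ≡ a′ → nE * (K * A) ≡ e →
        a′ ≤ a → K * a ≤ e + x → nE ≤ nS * (nS + α) → K * a * (A - a - α * A) ≤ x * A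
      -- The difference is a sum of three slacks: that of `Ka≤e+x` times `A`, that of the expansion
      -- inequality times `K * (A * A)`, and the growth of `y * (y + α * A)` from `a′` to `a`, times
      -- `K`.
      arithmetic K a a′ A e x nS nE α 0≤K 0≤a′ 0≤A 0≤α refl refl a′≤a Ka≤ nE≤ = ≤-by-difference
        (solve 7 (λ K a A x nS nE α → x :* A := K :* a :* (A :- a :- α :* A) :+
            ((((nE :* (K :* A) :+ x) :- K :* a) :* A :+ (nS :* (nS :+ α) :- nE) :* (K :* (A :* A)))
             :+ K :* ((a :- nS :* A) :* (a :+ nS :* A :+ α :* A)))) refl K a A x nS nE α)
        (+-nonneg (+-nonneg (*-nonneg (p≤q⇒0≤q-p Ka≤) 0≤A) (*-nonneg (p≤q⇒0≤q-p nE≤) (*-nonneg 0≤K (*-nonneg 0≤A 0≤A))))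
          (*-nonneg 0≤K (*-nonneg (p≤q⇒0≤q-p a′≤a) (+-nonneg (+-nonneg (≤-trans 0≤a′ a′≤a) 0≤a′) (*-nonneg 0≤α 0≤A)))))

-- Descent through the fat faces

∈-allSubsets : (σ : Subset n) → σ List.∈ allSubsets n
∈-allSubsets []          = Any.here refl
∈-allSubsets (false ∷ σ) = ∈-++⁺ˡ (∈-map⁺ (false ∷_) (∈-allSubsets σ))
∈-allSubsets {suc n} (true ∷ σ) = ∈-++⁺ʳ (map (false ∷_) (allSubsets n)) (∈-map⁺ (true ∷_) (∈-allSubsets σ))

any-allSubsets⁺ : (f : Subset n → Bool) (σ : Subset n) → T (f σ) → T (any f (allSubsets n))
any-allSubsets⁺ f σ h = any⁺ f (lose (∈-allSubsets σ) h)

any-allSubsets⁻ : (f : Subset n → Bool) → T (any f (allSubsets n)) → ∃ λ σ → T (f σ)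
any-allSubsets⁻ {n} f h = let σ , _ , fσ = find (any⁻ f (allSubsets n) h) in σ , fσ

¬T⇒Tnot : ∀ {b} → ¬ T b → T (not b)
¬T⇒Tnot {false} _ = tt
¬T⇒Tnot {true}  h = ⊥-elim (h tt)

Tnot⇒¬T : ∀ {b} → T (not b) → ¬ T b
Tnot⇒¬T {false} _ ()

^q-nonneg : ∀ {t} → 0ℚ ≤ t → ∀ k → 0ℚ ≤ t ^q k
^q-nonneg 0≤t zero    = 0≤1
^q-nonneg 0≤t (suc k) = *-nonneg 0≤t (^q-nonneg 0≤t k)

^q-antitone : ∀ {t} → 0ℚ ≤ t → t ≤ 1ℚ → ∀ {j k} → j ℕ.≤ k → t ^q k ≤ t ^q j
^q-antitone 0≤t t≤1 {k = zero}  ℕ.z≤n = ≤-refl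
^q-antitone {t} 0≤t t≤1 {k = suc k} ℕ.z≤n = ≤-trans (*-monoˡ-≤ 0≤t (^q-antitone 0≤t t≤1 {k = k} ℕ.z≤n)) (subst (_≤ 1ℚ) (sym (*-identityʳ t)) t≤1)
^q-antitone 0≤t t≤1 (ℕ.s≤s j≤k) = *-monoˡ-≤ 0≤t (^q-antitone 0≤t t≤1 j≤k)

module Expansion (X : Family n) (d : ℕ) (X-complex : IsComplex X) (X-dim : IsDimension X d)
  (α : ℚ) (0<α : 0ℚ < α) (X-expands : IsSkeletonExpander X d α)
  (γ : ℚ) (0≤γ : 0ℚ ≤ γ) (2β≤1 : (γ + α) + (γ + α) ≤ 1ℚ) where

  open Weights X d X-complex X-dim
  open Local X d X-complex X-dim

  β c : ℚ
  β = γ + α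
  c = 1ℚ - β

  0≤β : 0ℚ ≤ β
  0≤β = +-nonneg 0≤γ (<⇒≤ 0<α)

  mass : ℕ → (Subset n → Bool) → ℚ
  mass k P = lev k (λ σ → ind (P σ) * μ σ)

  weighted-nonneg : ∀ b σ → 0ℚ ≤ ind b * μ σ
  weighted-nonneg b σ = *-nonneg (ind-nonneg b) (μ-nonneg σ)

  -- Since `a ≤ c * A` with `c = 1ℚ - (γ + α)`, the factor `A - a - α * A` in `local-expansion` is
  -- at least `γ * A`, and `A` cancels.
  sparse-expansion : ∀ σ → ∣ σ ∣ ℕ.< d → (Q z : Subset n → Bool) →
    (∀ κ τ τ′ → T (X κ) → ∣ κ ∣ ≡ suc (suc ∣ σ ∣) → T (τ ⋖ᵇ κ) → T (τ′ ⋖ᵇ κ) → T (Q τ) → ¬ T (Q τ′) → T (z κ)) →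
    up σ (λ τ → ind (Q τ) * μ τ) ≤ c * (ι (suc ∣ σ ∣) * μ σ) →
    ι (suc (suc ∣ σ ∣)) * (γ * up σ (λ τ → ind (Q τ) * μ τ)) ≤ up σ (λ τ → up τ (λ κ → ind (z κ) * μ κ))
  sparse-expansion σ σ<d Q z mixed a≤cA with 0ℚ <? A′
    where A′ = ι (suc ∣ σ ∣) * μ σ
  -- With zero weight above `σ` nothing can be cancelled, but then `a` is zero too.
  ... | no A≯0 = begin
    K * (γ * a)   ≤⟨ *-monoˡ-≤ (ι-nonneg (suc (suc ∣ σ ∣))) (*-monoˡ-≤ 0≤γ a≤0) ⟩
    K * (γ * 0ℚ)  ≡⟨ trans (cong (K *_) (*-zeroʳ γ)) (*-zeroʳ K) ⟩
    0ℚ            ≤⟨ up-nonneg σ (λ τ → up-nonneg τ (λ κ → weighted-nonneg (z κ) κ)) ⟩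
    up σ (λ τ → up τ (λ κ → ind (z κ) * μ κ)) ∎
    where
    open ≤-Reasoning
    K = ι (suc (suc ∣ σ ∣))
    A = ι (suc ∣ σ ∣) * μ σ
    a = up σ (λ τ → ind (Q τ) * μ τ)
    A≡0 : A ≡ 0ℚ
    A≡0 = ≤-antisym (≮⇒≥ A≯0) (*-nonneg (ι-nonneg (suc ∣ σ ∣)) (μ-nonneg σ))
    a≤0 : a ≤ 0ℚ
    a≤0 = subst (a ≤_) (trans (cong (c *_) A≡0) (*-zeroʳ c)) a≤cA
  ... | yes 0<A = *-cancelˡ-≤ 0<A (≤-trans
    (arithmetic K a A γ α (*-nonneg (ι-nonneg (suc (suc ∣ σ ∣))) (up-nonneg σ (λ τ → weighted-nonneg (Q τ) τ))) a≤cA)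
    (≤-trans (local-expansion α 0<α X-expands σ Xσ σ<d Q z mixed) (≤-reflexive (*-comm x A))))
    where
    K = ι (suc (suc ∣ σ ∣))
    A = ι (suc ∣ σ ∣) * μ σ
    a = up σ (λ τ → ind (Q τ) * μ τ)
    x = up σ (λ τ → up τ (λ κ → ind (z κ) * μ κ))
    Xσ : T (X σ)
    Xσ with T? (X σ)
    ... | yes h = h
    ... | no ¬h = ⊥-elim (<-irrefl (sym (trans (cong (ι (suc ∣ σ ∣) *_) (μ-zero σ ¬h)) (*-zeroʳ (ι (suc ∣ σ ∣))))) 0<A)
    arithmetic : ∀ K a A γ α → 0ℚ ≤ K * a → a ≤ (1ℚ - (γ + α)) * A → A * (K * (γ * a)) ≤ K * a * (A - a - α * A)
    arithmetic K a A γ α 0≤Ka a≤ = ≤-by-difference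
      (solve 5 (λ K a A γ α → K :* a :* (A :- a :- α :* A) :=
        A :* (K :* (γ :* a)) :+ K :* a :* ((con 1ℚ :- (γ :+ α)) :* A :- a)) refl K a A γ α)
      (*-nonneg 0≤Ka (p≤q⇒0≤q-p a≤))

  -- ι (suc k) * μ σ is the total weight of the cofaces of σ; a σ with exactly the fraction c of
  -- them in P may or may not belong to S.
  record Fat (k : ℕ) (S P : Subset n → Bool) : Set where
    field
      fat  : ∀ σ → ∣ σ ∣ ≡ k → T (S σ) → c * (ι (suc k) * μ σ) ≤ up σ (λ τ → ind (P τ) * μ τ)
      thin : ∀ σ → ∣ σ ∣ ≡ k → ¬ T (S σ) → up σ (λ τ → ind (P τ) * μ τ) ≤ c * (ι (suc k) * μ σ)

  Δ : ℕ → (S P : Subset n → Bool) → ℚ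
  Δ k S P = lev k (λ σ → up σ (λ τ → ind (S σ xor P τ) * μ τ))

  ψ-intro : ∀ k P κ τ τ′ → T (X κ) → ∣ κ ∣ ≡ suc (suc k) → T (τ ⋖ᵇ κ) → T (τ′ ⋖ᵇ κ) → T (P τ) → ¬ T (P τ′) →
    T (ψ X k P κ)
  ψ-intro k P κ τ τ′ Xκ ∣κ∣ τ⋖κ τ′⋖κ Pτ ¬Pτ′ =
    T-∧⁺ (ℕ.≡⇒≡ᵇ ∣ κ ∣ (suc (suc k)) ∣κ∣) (T-∧⁺ Xκ (T-∧⁺
      (any-allSubsets⁺ _ τ (T-∧⁺ (⋖⇒⊆ τ κ τ⋖κ) (T-∧⁺ (size τ τ⋖κ) (T-∧⁺ Pτ (X-closed τ κ (⋖⇒⊆ τ κ τ⋖κ) Xκ)))))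
      (any-allSubsets⁺ _ τ′ (T-∧⁺ (⋖⇒⊆ τ′ κ τ′⋖κ) (T-∧⁺ (size τ′ τ′⋖κ) (T-∧⁺ (X-closed τ′ κ (⋖⇒⊆ τ′ κ τ′⋖κ) Xκ) (¬T⇒Tnot ¬Pτ′)))))))
    where
    size : ∀ ρ → T (ρ ⋖ᵇ κ) → T (∣ ρ ∣ ≡ᵇ suc k)
    size ρ ρ⋖κ = ℕ.≡⇒≡ᵇ ∣ ρ ∣ (suc k) (ℕ.suc-injective (trans (sym (⋖⇒∣∣ ρ κ ρ⋖κ)) ∣κ∣))

  ψ-elim : ∀ k P κ → T (ψ X k P κ) → ∃ λ τ → ∃ λ τ′ → T (τ ⋖ᵇ κ) × T (τ′ ⋖ᵇ κ) × T (P τ) × ¬ T (P τ′)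
  ψ-elim k P κ h =
    let ∣κ∣ , h₁ = T-∧⁻ {∣ κ ∣ ≡ᵇ suc (suc k)} h
        _ , h₂ = T-∧⁻ {X κ} h₁
        h₃ , h₄ = T-∧⁻ {any _ (allSubsets n)} h₂
        τ , hτ = any-allSubsets⁻ _ h₃
        τ′ , hτ′ = any-allSubsets⁻ _ h₄
        τ⊆κ , hτ₁ = T-∧⁻ {τ ⊆ᵇ κ} hτ
        ∣τ∣ , hτ₂ = T-∧⁻ {∣ τ ∣ ≡ᵇ suc k} hτ₁
        τ′⊆κ , hτ′₁ = T-∧⁻ {τ′ ⊆ᵇ κ} hτ′
        ∣τ′∣ , hτ′₂ = T-∧⁻ {∣ τ′ ∣ ≡ᵇ suc k} hτ′₁
    in τ , τ′ , ⋖-intro τ κ τ⊆κ (size τ ∣κ∣ ∣τ∣) , ⋖-intro τ′ κ τ′⊆κ (size τ′ ∣κ∣ ∣τ′∣) ,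
       proj₁ (T-∧⁻ {P τ} hτ₂) , Tnot⇒¬T (proj₂ (T-∧⁻ {X τ′} hτ′₂))
    where
    size : ∀ ρ → T (∣ κ ∣ ≡ᵇ suc (suc k)) → T (∣ ρ ∣ ≡ᵇ suc k) → ∣ κ ∣ ≡ suc ∣ ρ ∣
    size ρ a b = trans (ℕ.≡ᵇ⇒≡ ∣ κ ∣ (suc (suc k)) a) (cong suc (sym (ℕ.≡ᵇ⇒≡ ∣ ρ ∣ (suc k) b)))

  Δ-nonneg : ∀ k S P → 0ℚ ≤ Δ k S P
  Δ-nonneg k S P = lev-nonneg k (λ σ → up-nonneg σ (λ τ → weighted-nonneg (S σ xor P τ) τ))

  -- Outside `S` the disagreeing cofaces are those in `P`, few by thinness. Inside `S` they are
  -- those not in `P`, at most a fraction `β` of all, and `β ≤ c` because `2β ≤ 1`.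
  disagreement-sparse : ∀ {k S P} → Fat k S P → k ℕ.≤ d → ∀ σ → ∣ σ ∣ ≡ k →
    up σ (λ τ → ind (S σ xor P τ) * μ τ) ≤ c * (ι (suc k) * μ σ)
  disagreement-sparse {k} {S} {P} F k≤d σ e = go (S σ) refl
    where
    A = ι (suc k) * μ σ
    a = up σ (λ τ → ind (P τ) * μ τ)
    b = up σ (λ τ → ind (not (P τ)) * μ τ)
    a+b≡A : a + b ≡ A
    a+b≡A = begin
      a + b                                                   ≡⟨ up-+ σ _ _ ⟨
      up σ (λ τ → ind (P τ) * μ τ + ind (not (P τ)) * μ τ)    ≡⟨ up-cong σ (λ τ _ → split (P τ) (μ τ)) ⟩
      up σ μ                                                  ≡⟨ up-μ σ (subst (ℕ._≤ d) (sym e) k≤d) ⟩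
      ι (suc ∣ σ ∣) * μ σ                                     ≡⟨ cong (λ m → ι (suc m) * μ σ) e ⟩
      A                                                       ∎
      where
      open ≡-Reasoning
      split : ∀ p m → ind p * m + ind (not p) * m ≡ m
      split true  = solve 1 (λ m → con 1ℚ :* m :+ con 0ℚ :* m := m) refl
      split false = solve 1 (λ m → con 0ℚ :* m :+ con 1ℚ :* m := m) refl
    complement : ∀ a b β → 0ℚ ≤ a + b → β + β ≤ 1ℚ → (1ℚ - β) * (a + b) ≤ a → b ≤ (1ℚ - β) * (a + b)
    complement a b β 0≤ 2β≤1 h = ≤-by-difference
      (solve 3 (λ a b β → (con 1ℚ :- β) :* (a :+ b) := b :+ ((a :- (con 1ℚ :- β) :* (a :+ b)) :+ (con 1ℚ :- (β :+ β)) :* (a :+ b))) refl a b β)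
      (+-nonneg (p≤q⇒0≤q-p h) (*-nonneg (p≤q⇒0≤q-p 2β≤1) 0≤))
    go : ∀ s → S σ ≡ s → up σ (λ τ → ind (s xor P τ) * μ τ) ≤ c * A
    go false Sσ = Fat.thin F σ e (λ h → subst T Sσ h)
    go true  Sσ = subst (λ y → b ≤ c * y) a+b≡A (complement a b β
      (subst (0ℚ ≤_) (sym a+b≡A) (*-nonneg (ι-nonneg (suc k)) (μ-nonneg σ))) 2β≤1
      (subst (λ y → c * y ≤ a) (sym a+b≡A) (Fat.fat F σ e (subst T (sym Sσ) tt))))

  -- Sparse expansion is summed over the level of `σ`. Two uses of `lev-up` produce the factors
  -- `k+1` and `k+2`, and the latter cancels against `K`.
  Δ≤ψ : ∀ {k S P} → Fat k S P → k ℕ.< d → γ * Δ k S P ≤ ι (suc k) * mass (suc (suc k)) (ψ X k P)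
  Δ≤ψ {k} {S} {P} F k<d = *-cancelˡ-≤ (ι-suc-pos (suc k)) (begin
    K * (γ * Δ k S P)
      ≡⟨ trans (lev-* k K _) (cong (K *_) (lev-* k γ _)) ⟨
    lev k (λ σ → K * (γ * up σ (λ τ → ind (S σ xor P τ) * μ τ)))
      ≤⟨ lev-mono k step ⟩
    lev k (λ σ → up σ (λ τ → up τ (λ κ → ind (ψ X k P κ) * μ κ)))
      ≡⟨ trans (lev-up k _) (cong (ι (suc k) *_) (lev-up (suc k) _)) ⟩
    ι (suc k) * (K * Ψ)
      ≡⟨ *-swap (ι (suc k)) K Ψ ⟩
    K * (ι (suc k) * Ψ) ∎)
    where
    open ≤-Reasoning
    K = ι (suc (suc k))
    Ψ = mass (suc (suc k)) (ψ X k P)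
    mixed : ∀ s κ τ τ′ → T (X κ) → ∣ κ ∣ ≡ suc (suc k) → T (τ ⋖ᵇ κ) → T (τ′ ⋖ᵇ κ) →
      T (s xor P τ) → ¬ T (s xor P τ′) → T (ψ X k P κ)
    mixed false κ τ τ′ Xκ ∣κ∣ τ⋖κ τ′⋖κ q ¬q = ψ-intro k P κ τ τ′ Xκ ∣κ∣ τ⋖κ τ′⋖κ q ¬q
    -- For `σ` in `S`, disagreeing means lying outside `P`, so the two facets exchange roles.
    mixed true  κ τ τ′ Xκ ∣κ∣ τ⋖κ τ′⋖κ q ¬q with T? (P τ′)
    ... | yes p = ψ-intro k P κ τ′ τ Xκ ∣κ∣ τ′⋖κ τ⋖κ p (Tnot⇒¬T q)
    ... | no ¬p = ⊥-elim (¬q (¬T⇒Tnot ¬p))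
    step : ∀ σ → ∣ σ ∣ ≡ k → K * (γ * up σ (λ τ → ind (S σ xor P τ) * μ τ)) ≤ up σ (λ τ → up τ (λ κ → ind (ψ X k P κ) * μ κ))
    step σ refl = sparse-expansion σ k<d (λ τ → S σ xor P τ) (ψ X k P) (mixed (S σ)) (disagreement-sparse F (ℕ.<⇒≤ k<d) σ refl)

  -- This holds for every `P′`: of two facets of `κ`, one in `P` and one not, exactly one disagrees
  -- with the value `P′ κ`.
  ψ≤Δ : ∀ k P P′ → mass (suc (suc k)) (ψ X k P) ≤ Δ (suc k) P P′
  ψ≤Δ k P P′ = begin
    mass (suc (suc k)) (ψ X k P)
      ≤⟨ lev-mono (suc (suc k)) (λ κ _ → step κ) ⟩
    lev (suc (suc k)) (λ κ → down κ (λ τ → ind (P τ xor P′ κ) * μ κ))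
      ≡⟨ lev-up≡lev-down (suc k) (λ τ κ → ind (P τ xor P′ κ) * μ κ) ⟨
    Δ (suc k) P P′ ∎
    where
    open ≤-Reasoning
    differ : ∀ {a b} y → T a → ¬ T b → T (a xor y) ⊎ T (b xor y)
    differ {true} {false} true  _ _ = inj₂ tt
    differ {true} {false} false _ _ = inj₁ tt
    differ {b = true} _ _ ¬b = ⊥-elim (¬b tt)
    bound : ∀ κ τ → T (τ ⋖ᵇ κ) → T (P τ xor P′ κ) → ind (ψ X k P κ) * μ κ ≤ down κ (λ τ → ind (P τ xor P′ κ) * μ κ)
    bound κ τ τ⋖κ h = ≤-trans
      (*-monoʳ-≤ (μ-nonneg κ) (≤-trans (ind-≤1 (ψ X k P κ)) (≤-reflexive (sym (T⇒ind≡1 h)))))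
      (term≤down τ κ {λ τ → ind (P τ xor P′ κ) * μ κ} (λ τ → weighted-nonneg (P τ xor P′ κ) κ) τ⋖κ)
    step : ∀ κ → ind (ψ X k P κ) * μ κ ≤ down κ (λ τ → ind (P τ xor P′ κ) * μ κ)
    step κ with T? (ψ X k P κ)
    ... | yes h = let τ , τ′ , τ⋖κ , τ′⋖κ , Pτ , ¬Pτ′ = ψ-elim k P κ h in
      [ bound κ τ τ⋖κ , bound κ τ′ τ′⋖κ ]′ (differ (P′ κ) Pτ ¬Pτ′)
    ... | no ¬h = ≤-trans (≤-reflexive (trans (cong (_* μ κ) (ind≡0 ¬h)) (*-zeroˡ (μ κ))))
      (Σ-nonneg (λ τ → *-nonneg (cov-nonneg τ κ) (weighted-nonneg (P τ xor P′ κ) κ)))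

  -- In a covering pair whose upper member lies in `P`, either the two members disagree or the lower
  -- one lies in `S`.
  mass-step : ∀ k S P → k ℕ.≤ d → ι (suc k) * mass (suc k) P ≤ Δ k S P + ι (suc k) * mass k S
  mass-step k S P k≤d = begin
    ι (suc k) * mass (suc k) P
      ≡⟨ lev-up k _ ⟨
    lev k (λ σ → up σ (λ τ → ind (P τ) * μ τ))
      ≤⟨ lev-mono k (λ σ _ → up-mono σ (λ τ _ → split (S σ) (P τ) τ)) ⟩
    lev k (λ σ → up σ (λ τ → ind (S σ xor P τ) * μ τ + ind (S σ) * μ τ))
      ≡⟨ trans (lev-cong k (λ σ _ → up-+ σ _ _)) (lev-+ k _ _) ⟩
    Δ k S P + lev k (λ σ → up σ (λ τ → ind (S σ) * μ τ))
      ≡⟨ cong (Δ k S P +_) (trans (lev-cong k above) (lev-* k (ι (suc k)) _)) ⟩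
    Δ k S P + ι (suc k) * mass k S ∎
    where
    open ≤-Reasoning
    split : ∀ s p τ → ind p * μ τ ≤ ind (s xor p) * μ τ + ind s * μ τ
    split false p     τ = ≤-by-difference refl (weighted-nonneg false τ)
    split true  true  τ = ≤-by-difference (+-comm (0ℚ * μ τ) (1ℚ * μ τ)) (weighted-nonneg false τ)
    split true  false τ = ≤-trans (≤-reflexive (*-zeroˡ (μ τ))) (+-nonneg (weighted-nonneg true τ) (weighted-nonneg true τ))
    above : ∀ σ → ∣ σ ∣ ≡ k → up σ (λ τ → ind (S σ) * μ τ) ≡ ι (suc k) * (ind (S σ) * μ σ)
    above σ refl = trans (up-* σ (ind (S σ)) μ) (trans (cong (ind (S σ) *_) (up-μ σ k≤d)) (*-swap (ind (S σ)) (ι (suc k)) (μ σ)))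

  fat-mass : ∀ {k S P} → Fat k S P → c * mass k S ≤ mass (suc k) P
  fat-mass {k} {S} {P} F = *-cancelˡ-≤ (ι-suc-pos k) (begin
    ι (suc k) * (c * mass k S)
      ≡⟨ trans (lev-* k (ι (suc k)) _) (cong (ι (suc k) *_) (lev-* k c _)) ⟨
    lev k (λ σ → ι (suc k) * (c * (ind (S σ) * μ σ)))
      ≤⟨ lev-mono k step ⟩
    lev k (λ σ → up σ (λ τ → ind (P τ) * μ τ))
      ≡⟨ lev-up k _ ⟩
    ι (suc k) * mass (suc k) P ∎)
    where
    open ≤-Reasoning
    step : ∀ σ → ∣ σ ∣ ≡ k → ι (suc k) * (c * (ind (S σ) * μ σ)) ≤ up σ (λ τ → ind (P τ) * μ τ)
    step σ e with T? (S σ)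
    ... | yes h = ≤-trans (≤-reflexive (trans (cong (λ y → ι (suc k) * (c * (y * μ σ))) (T⇒ind≡1 h))
      (solve 3 (λ a b m → a :* (b :* (con 1ℚ :* m)) := b :* (a :* m)) refl (ι (suc k)) c (μ σ)))) (Fat.fat F σ e h)
    ... | no ¬h = ≤-trans (≤-reflexive (trans (cong (λ y → ι (suc k) * (c * (y * μ σ))) (ind≡0 ¬h))
      (solve 3 (λ a b m → a :* (b :* (con 0ℚ :* m)) := con 0ℚ) refl (ι (suc k)) c (μ σ)))) (up-nonneg σ (λ τ → weighted-nonneg (P τ) τ))

  mass-nonneg : ∀ k P → 0ℚ ≤ mass k P
  mass-nonneg k P = lev-nonneg k (λ σ → weighted-nonneg (P σ) σ)

  mass≤1 : ∀ k P → k ℕ.≤ suc d → mass k P ≤ 1ℚ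
  mass≤1 k P k≤ = ≤-trans
    (lev-mono k (λ σ _ → ≤-trans (*-monoʳ-≤ (μ-nonneg σ) (ind-≤1 (P σ))) (≤-reflexive (*-identityˡ (μ σ)))))
    (≤-reflexive (lev-μ k k≤))

  -- Because masses are at most 1, the multiplicative loss `c` becomes an additive loss `β`, which
  -- accumulates linearly along the descent.
  mass-decrease : ∀ {k S P} → Fat k S P → k ℕ.≤ d → mass k S ≤ mass (suc k) P + β
  mass-decrease {k} {S} {P} F k≤d = ≤-by-difference
    (solve 3 (λ m m′ β → m′ :+ β := m :+ ((m′ :- (con 1ℚ :- β) :* m) :+ β :* (con 1ℚ :- m))) refl (mass k S) (mass (suc k) P) β)
    (+-nonneg (p≤q⇒0≤q-p (fat-mass F)) (*-nonneg 0≤β (p≤q⇒0≤q-p (mass≤1 k S (ℕ.m≤n⇒m≤1+n k≤d)))))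

  mass-zero : ∀ S → mass 0 S ≡ ind (S ∅)
  mass-zero S = trans (lev-zero _) (trans (cong (ind (S ∅) *_) μ∅≡1) (*-identityʳ (ind (S ∅))))

  -- The number counts steps down from `W`; the threshold reads the size from `σ` itself, so one
  -- definition serves every level.
  fatFaces : ℕ → (Subset n → Bool) → Subset n → Bool
  fatFaces zero    W = W
  fatFaces (suc m) W σ = ⌊ c * (ι (suc ∣ σ ∣) * μ σ) ≤? up σ (λ τ → ind (fatFaces m W τ) * μ τ) ⌋

  fatFaces-Fat : ∀ m W k → Fat k (fatFaces (suc m) W) (fatFaces m W)
  fatFaces-Fat m W k = record
    { fat  = λ { σ refl h → toWitness h }
    ; thin = λ { σ refl ¬h → <⇒≤ (≰⇒> (¬h ∘ fromWitness)) }
    }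

  module Descent (i : ℕ) (i<d : i ℕ.< d) (W : Subset n → Bool) (W≤½ : mass (suc i) W ≤ ½)
    (2dβ<1 : ι d * β + ι d * β < 1ℚ) where

    S : ℕ → Subset n → Bool
    S k = fatFaces (suc i ∸ k) W

    S-last : S (suc i) ≡ W
    S-last = cong (λ m → fatFaces m W) (ℕ.n∸n≡0 i)

    S-Fat : ∀ k → k ℕ.≤ i → Fat k (S k) (S (suc k))
    -- For `k ≤ i` the step count `suc i ∸ k` is a successor, which exposes the recursive clause of
    -- `fatFaces`.
    S-Fat k k≤i = subst (λ m → Fat k (fatFaces m W) (S (suc k))) (sym (ℕ.+-∸-assoc 1 k≤i)) (fatFaces-Fat (i ∸ k) W k)

    mass-lower : ∀ k → k ℕ.≤ suc i → mass 0 (S 0) ≤ mass k (S k) + ι k * β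
    mass-lower zero    _ = ≤-reflexive (solve 2 (λ m b → m := m :+ con 0ℚ :* b) refl (mass 0 (S 0)) β)
    mass-lower (suc k) (ℕ.s≤s k≤i) = begin
      mass 0 (S 0)                                ≤⟨ mass-lower k (ℕ.m≤n⇒m≤1+n k≤i) ⟩
      mass k (S k) + ι k * β                      ≤⟨ +-monoˡ-≤ (ι k * β) (mass-decrease (S-Fat k k≤i) (ℕ.≤-trans k≤i (ℕ.<⇒≤ i<d))) ⟩
      mass (suc k) (S (suc k)) + β + ι k * β      ≡⟨ solve 3 (λ m b j → m :+ b :+ j :* b := m :+ (con 1ℚ :+ j) :* b) refl
                                                       (mass (suc k) (S (suc k))) β (ι k) ⟩
      mass (suc k) (S (suc k)) + ι (suc k) * β    ∎
      where open ≤-Reasoning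

    -- The empty face alone carries weight 1, so the mass is 0 or 1. The value 1 would give
    -- `1ℚ ≤ ½ + ι d * β`, contrary to `2dβ<1`.
    ∅-thin : mass 0 (S 0) ≡ 0ℚ
    ∅-thin with T? (S 0 ∅)
    ... | no ¬h = trans (mass-zero (S 0)) (ind≡0 ¬h)
    ... | yes h = ⊥-elim (≤⇒≯ (≤-by-difference {u = (½ + ι d * β - 1ℚ) + (½ + ι d * β - 1ℚ)}
        (solve 1 (λ y → y :+ y := con 1ℚ :+ ((con ½ :+ y :- con 1ℚ) :+ (con ½ :+ y :- con 1ℚ))) refl (ι d * β))
        (+-nonneg (p≤q⇒0≤q-p 1≤) (p≤q⇒0≤q-p 1≤))) 2dβ<1)
      where
      open ≤-Reasoning
      1≤ : 1ℚ ≤ ½ + ι d * β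
      1≤ = begin
        1ℚ                                      ≡⟨ trans (mass-zero (S 0)) (T⇒ind≡1 h) ⟨
        mass 0 (S 0)                            ≤⟨ mass-lower (suc i) ℕ.≤-refl ⟩
        mass (suc i) (S (suc i)) + ι (suc i) * β ≡⟨ cong (λ V → mass (suc i) V + ι (suc i) * β) S-last ⟩
        mass (suc i) W + ι (suc i) * β          ≤⟨ +-mono-≤ W≤½ (*-monoʳ-≤ 0≤β (ι-mono-≤ i<d)) ⟩
        ½ + ι d * β                             ∎

    module _ (t : ℚ) (0≤t : 0ℚ ≤ t) (t≤1 : t ≤ 1ℚ) (dt≤γ : ι d * t ≤ γ) where

      -- At the bottom, `∅-thin` removes the extra term of `mass-step`. Further up, that term is
      -- bounded by the previous `Δ`, which `Δ≤ψ` and `ψ≤Δ` bound by the current one.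
      Δ-bounds-mass : ∀ k → k ℕ.≤ i → (t ^q k) * mass (suc k) (S (suc k)) ≤ Δ k (S k) (S (suc k))
      Δ-bounds-mass zero k≤i = begin
        1ℚ * mass 1 (S 1)                     ≤⟨ mass-step 0 (S 0) (S 1) ℕ.z≤n ⟩
        Δ 0 (S 0) (S 1) + 1ℚ * mass 0 (S 0)   ≡⟨ cong (λ m → Δ 0 (S 0) (S 1) + 1ℚ * m) ∅-thin ⟩
        Δ 0 (S 0) (S 1) + 0ℚ                  ≡⟨ +-identityʳ (Δ 0 (S 0) (S 1)) ⟩
        Δ 0 (S 0) (S 1)                       ∎
        where open ≤-Reasoning
      Δ-bounds-mass (suc k) k<i = *-cancelˡ-≤ (ι-suc-pos (suc k)) (arithmetic (ι (suc k)) t (t ^q k) γ s s′ D D′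
        0≤t (^q-nonneg 0≤t (suc k)) (^q-antitone 0≤t t≤1 {k = suc k} ℕ.z≤n) (*-nonneg (ι-nonneg (suc (suc k))) 0≤t)
        (Δ-nonneg k (S k) (S (suc k))) (Δ-nonneg (suc k) (S (suc k)) (S (suc (suc k))))
        (≤-trans (*-monoʳ-≤ 0≤t (ι-mono-≤ (ℕ.≤-trans (ℕ.s≤s k<i) i<d))) dt≤γ)
        (mass-step (suc k) (S (suc k)) (S (suc (suc k))) (ℕ.≤-trans k<i (ℕ.<⇒≤ i<d)))
        (≤-trans (Δ≤ψ (S-Fat k (ℕ.<⇒≤ k<i)) (ℕ.<-trans k<i i<d))
          (*-monoˡ-≤ (ι-nonneg (suc k)) (ψ≤Δ k (S (suc k)) (S (suc (suc k))))))
        (Δ-bounds-mass k (ℕ.<⇒≤ k<i)))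
        where
        s  = mass (suc k) (S (suc k))
        s′ = mass (suc (suc k)) (S (suc (suc k)))
        D  = Δ k (S k) (S (suc k))
        D′ = Δ (suc k) (S (suc k)) (S (suc (suc k)))
        arithmetic : ∀ K t T γ s s′ D D′ → 0ℚ ≤ t → 0ℚ ≤ t * T → t * T ≤ 1ℚ → 0ℚ ≤ (1ℚ + K) * t → 0ℚ ≤ D → 0ℚ ≤ D′ →
          (1ℚ + K) * t ≤ γ → (1ℚ + K) * s′ ≤ D′ + (1ℚ + K) * s → γ * D ≤ K * D′ → T * s ≤ D →
          (1ℚ + K) * ((t * T) * s′) ≤ (1ℚ + K) * D′
        -- With `K = k+1` and `T = t^k`, the chain is `(K+1)tTs′ ≤ tTD′ + (K+1)tTs ≤ D′ + (K+1)tD ≤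
        -- D′ + γD ≤ (K+1)D′`; each bracket is one slack.
        arithmetic K t T γ s s′ D D′ 0≤t 0≤tT tT≤1 0≤Kt 0≤D 0≤D′ Kt≤γ step γD≤ Ts≤D = ≤-by-difference
          (solve 8 (λ K t T γ s s′ D D′ → (con 1ℚ :+ K) :* D′ := (con 1ℚ :+ K) :* ((t :* T) :* s′) :+
             (((((t :* T) :* ((D′ :+ (con 1ℚ :+ K) :* s) :- (con 1ℚ :+ K) :* s′)
             :+ (con 1ℚ :- t :* T) :* D′)
             :+ ((con 1ℚ :+ K) :* t) :* (D :- T :* s))
             :+ (γ :- (con 1ℚ :+ K) :* t) :* D)
             :+ (K :* D′ :- γ :* D))) refl K t T γ s s′ D D′)
          (+-nonneg (+-nonneg (+-nonneg (+-nonneg (*-nonneg 0≤tT (p≤q⇒0≤q-p step)) (*-nonneg (p≤q⇒0≤q-p tT≤1) 0≤D′))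
            (*-nonneg 0≤Kt (p≤q⇒0≤q-p Ts≤D))) (*-nonneg (p≤q⇒0≤q-p Kt≤γ) 0≤D)) (p≤q⇒0≤q-p γD≤))

      -- As `t ≤ 1`, the exponent `d` may be lowered to `i+1`. The induction uses `i` of the factors
      -- `t`; the last one becomes `γ` through `dt≤γ`.
      colorful : (t ^q d) * mass (suc i) W ≤ mass (suc (suc i)) (ψ X i W)
      colorful = ≤-trans (*-monoʳ-≤ (mass-nonneg (suc i) W) (^q-antitone 0≤t t≤1 i<d))
        (*-cancelˡ-≤ {ι d} (<-≤-trans (ι-suc-pos i) (ι-mono-≤ i<d)) (begin
          ι d * (t ^q suc i * m)  ≡⟨ solve 4 (λ d t T m → d :* ((t :* T) :* m) := (d :* t) :* (T :* m)) refl (ι d) t (t ^q i) m ⟩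
          ι d * t * (t ^q i * m)  ≤⟨ *-monoˡ-≤ (*-nonneg (ι-nonneg d) 0≤t)
                                       (subst (λ V → t ^q i * mass (suc i) V ≤ Δ i (S i) V) S-last (Δ-bounds-mass i ℕ.≤-refl)) ⟩
          ι d * t * D             ≤⟨ *-monoʳ-≤ (Δ-nonneg i (S i) W) dt≤γ ⟩
          γ * D                   ≤⟨ Δ≤ψ (subst (Fat i (S i)) S-last (S-Fat i ℕ.≤-refl)) i<d ⟩
          ι (suc i) * Ψ           ≤⟨ *-monoʳ-≤ (mass-nonneg (suc (suc i)) (ψ X i W)) (ι-mono-≤ i<d) ⟩
          ι d * Ψ                 ∎))
        where
        open ≤-Reasoning
        m = mass (suc i) W
        D = Δ i (S i) W
        Ψ = mass (suc (suc i)) (ψ X i W)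

-- Rational consequences of the root condition

-- The binomial expansion of (1 + β√2)^k gives 1 + kβ√2 as a lower bound, coefficientwise.
power-lower-bound : ∀ {β} → 0ℚ ≤ β → ∀ k →
  1ℚ ≤ Q√2.re (⟨ 1ℚ , β ⟩ ^√ k) × ι k * β ≤ Q√2.ir (⟨ 1ℚ , β ⟩ ^√ k)
power-lower-bound {β} 0≤β zero    = ≤-refl , ≤-reflexive (*-zeroˡ β)
power-lower-bound {β} 0≤β (suc k) =
  ≤-by-difference
    (solve 3 (λ a b β → con 1ℚ :* a :+ con (ℤ.+ 2 / 1) :* (β :* b) :=
      con 1ℚ :+ ((a :- con 1ℚ) :+ con (ℤ.+ 2 / 1) :* (β :* b))) refl a b β)
    (+-nonneg (p≤q⇒0≤q-p 1≤a) (*-nonneg (nonNegative⁻¹ (ℤ.+ 2 / 1)) (*-nonneg 0≤β 0≤b))) ,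
  ≤-by-difference (solve 4 (λ a b β k → con 1ℚ :* b :+ β :* a := (con 1ℚ :+ k) :* β :+ ((b :- k :* β) :+ β :* (a :- con 1ℚ))) refl a b β (ι k))
    (+-nonneg (p≤q⇒0≤q-p kβ≤b) (*-nonneg 0≤β (p≤q⇒0≤q-p 1≤a)))
  where
  a = Q√2.re (⟨ 1ℚ , β ⟩ ^√ k)
  b = Q√2.ir (⟨ 1ℚ , β ⟩ ^√ k)
  1≤a : 1ℚ ≤ a
  1≤a = proj₁ (power-lower-bound 0≤β k)
  kβ≤b : ι k * β ≤ b
  kβ≤b = proj₂ (power-lower-bound 0≤β k)
  0≤b : 0ℚ ≤ b
  0≤b = ≤-trans (*-nonneg (ι-nonneg k) 0≤β) kβ≤b

-- From `1ℚ ≤ a`, the positive number `c = 2 - a` is at most 1, so `b` at least 1 would give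
-- `2b² ≥ 2 > c²`.
Lt2⇒ir<1 : ∀ {a b} → 1ℚ ≤ a → 0ℚ ≤ b → Lt2 ⟨ a , b ⟩ → b < 1ℚ
Lt2⇒ir<1 1≤a 0≤b (inj₂ (b<0 , _)) = ⊥-elim (≤⇒≯ 0≤b b<0)
Lt2⇒ir<1 {a} {b} 1≤a 0≤b (inj₁ (_ , 0<c , 2b²<c²)) = ≰⇒> (λ 1≤b → ≤⇒≯ (≤-by-difference
  (solve 2 (λ a b → con (ℤ.+ 2 / 1) :* (b :* b) := (con (ℤ.+ 2 / 1) :- a) :* (con (ℤ.+ 2 / 1) :- a) :+
    ((con 1ℚ :+ (b :- con 1ℚ) :* ((b :+ con 1ℚ) :+ (b :+ con 1ℚ)))
     :+ (a :- con 1ℚ) :* ((con (ℤ.+ 2 / 1) :- a) :+ con 1ℚ))) refl a b)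
  (+-nonneg (+-nonneg 0≤1 (*-nonneg (p≤q⇒0≤q-p 1≤b) (+-nonneg (+-nonneg 0≤b 0≤1) (+-nonneg 0≤b 0≤1))))
    (*-nonneg (p≤q⇒0≤q-p 1≤a) (+-nonneg (<⇒≤ 0<c) 0≤1)))) 2b²<c²)

BelowRoot⇒2^dβ<1 : ∀ d {β} → 0ℚ ≤ β → BelowRoot d β → ι (2 ℕ.^ d) * β < 1ℚ
BelowRoot⇒2^dβ<1 d {β} 0≤β h =
  let 1≤a , kβ≤b = power-lower-bound 0≤β (2 ℕ.^ d)
  in ≤-<-trans kβ≤b (Lt2⇒ir<1 1≤a (≤-trans (*-nonneg (ι-nonneg (2 ℕ.^ d)) 0≤β) kβ≤b) h)

2d≤2^d : ∀ d → d ℕ.≥ 1 → 2 ℕ.* d ℕ.≤ 2 ℕ.^ d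
2d≤2^d (suc zero)    _ = ℕ.≤-refl
2d≤2^d (suc (suc d)) _ = ℕ.*-monoʳ-≤ 2 (begin
  2 ℕ.+ d              ≤⟨ ℕ.+-monoʳ-≤ 2 (ℕ.m≤m+n d (d ℕ.+ 0)) ⟩
  2 ℕ.+ 2 ℕ.* d        ≡⟨ ℕ.*-suc 2 d ⟨
  2 ℕ.* suc d          ≤⟨ 2d≤2^d (suc d) (ℕ.s≤s ℕ.z≤n) ⟩
  2 ℕ.^ suc d          ∎)
  where open ℕ.≤-Reasoning

theorem2p1 : (n d : ℕ) → d ≥ 1 → (X : Family n) → IsComplex X → IsDimension X d → IsPure X d →
    (α : ℚ) → 0ℚ < α → IsSkeletonExpander X d α → BelowRoot d α →
    IsColorfulBound X d α
theorem2p1 n d d≥1 X X-complex X-dim _ α 0<α X-expands _ i i<d W _ _ W≤½ t 0<t below =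
  subst (λ m → (t ^q d) * m ≤ norm X d (suc i) (ψ X i W)) (sym (norm≡lev i (ℕ.<⇒≤ i<d) W))
    (subst ((t ^q d) * mass (suc i) W ≤_) (sym (norm≡lev (suc i) i<d (ψ X i W)))
      (colorful t 0≤t t≤1 dt≤γ))
  where
  γ : ℚ
  -- With this choice `γ + α` is exactly the argument of `BelowRoot` in the colorful bound.
  γ = (ℤ.+ (2 ℕ.* d) / 1) * t
  0≤t : 0ℚ ≤ t
  0≤t = <⇒≤ 0<t
  γ≡ : γ ≡ ι (2 ℕ.* d) * t
  γ≡ = cong (_* t) (sym (ι≡/1 (2 ℕ.* d)))
  0≤γ : 0ℚ ≤ γ
  0≤γ = subst (0ℚ ≤_) (sym γ≡) (*-nonneg (ι-nonneg (2 ℕ.* d)) 0≤t)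
  0≤β : 0ℚ ≤ γ + α
  0≤β = +-nonneg 0≤γ (<⇒≤ 0<α)
  dβ+dβ≡2dβ : ∀ β → ι d * β + ι d * β ≡ ι (2 ℕ.* d) * β
  dβ+dβ≡2dβ β = trans (sym (*-distribʳ-+ β (ι d) (ι d)))
    (cong (_* β) (trans (sym (ι-+ d d)) (cong ι (cong (d ℕ.+_) (sym (ℕ.+-identityʳ d))))))
  2dβ<1 : ι d * (γ + α) + ι d * (γ + α) < 1ℚ
  2dβ<1 = subst (_< 1ℚ) (sym (dβ+dβ≡2dβ (γ + α)))
    (≤-<-trans (*-monoʳ-≤ 0≤β (ι-mono-≤ (2d≤2^d d d≥1))) (BelowRoot⇒2^dβ<1 d 0≤β below))
  q≤dq : ∀ {q} → 0ℚ ≤ q → q ≤ ι d * q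
  q≤dq {q} 0≤q = subst (_≤ ι d * q) (*-identityˡ q) (*-monoʳ-≤ 0≤q (ι-mono-≤ {1} d≥1))
  2β≤1 : (γ + α) + (γ + α) ≤ 1ℚ
  2β≤1 = ≤-trans (+-mono-≤ (q≤dq 0≤β) (q≤dq 0≤β)) (<⇒≤ 2dβ<1)
  dt≤γ : ι d * t ≤ γ
  dt≤γ = subst (ι d * t ≤_) (sym γ≡) (*-monoʳ-≤ 0≤t (ι-mono-≤ (ℕ.m≤m+n d (d ℕ.+ 0))))
  t≤1 : t ≤ 1ℚ
  -- The chain is `t ≤ dt ≤ γ ≤ β ≤ 2β ≤ 1`.
  t≤1 = ≤-trans (q≤dq 0≤t) (≤-trans dt≤γ (≤-trans (≤-by-difference refl (<⇒≤ 0<α))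
    (≤-trans (≤-by-difference refl 0≤β) 2β≤1)))
  open Weights X d X-complex X-dim using (norm≡lev)
  open Expansion X d X-complex X-dim α 0<α X-expands γ 0≤γ 2β≤1 using (mass; module Descent)
  open Descent i i<d W (subst (_≤ ½) (norm≡lev i (ℕ.<⇒≤ i<d) W) W≤½) 2dβ<1 using (colorful)
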